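{- Let $E=\{x_1,\dots,x_n\}\subset\mathbb{R}^2$ with $x_i\,\mathcal{I}\,x_j$ for all $i\neq j$. The Max-Sum-Min $p$-dispersion problem is polynomially solvable to optimality in $E$. The cases $p=2,3$ are solvable in $O(n)$ time using $O(1)$ additional memory space. The case $p=4$ (resp. $p=5$) is solvable in $O(n^2)$ (resp. $O(n^3)$) time using $O(1)$ additional memory space. For $p>5$ there is an algorithm (a dynamic programming algorithm) that solves it, returning the optimal value and an optimal selection, in $O(pn^3)$ time and $O(pn^2)$ memory space.
   Context: For $y=(y^1,y^2),z=(z^1,z^2)\in\mathbb{R}^2$ write $y\prec z$ iff $y^1<z^1$ and $y^2>z^2$, and $y\,\mathcal{I}\,z$ iff $y\prec z$ or $z\prec y$ (so $E$ is a two-dimensional Pareto front). Fix $\alpha>0$ and let $d$ be the Euclidean distance on $\mathbb{R}^2$. For an integer $2\le p\le n$, let $D_p$ be the set of $p$-tuples $(z_1,\dots,z_p)\in E^p$ of pairwise distinct points. The Max-Sum-Min $p$-dispersion problem is $\max_{(z_1,\dots,z_p)\in D_p}\sum_{i=1}^{p}\min_{j\neq i,\,1\le j\le p}d(z_i,z_j)^\alpha$. Complexities are in a model where arithmetic operations, comparisons and evaluation of $d(\cdot,\cdot)^\alpha$ take $O(1)$ time; "additional memory space" excludes the storage of the input. -}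

module Defs where

open import Algebra.Bundles using (CommutativeRing)
open import Algebra.Structures using (IsCommutativeRing)
open import Data.Bool using (Bool; true; false; if_then_else_)
open import Data.Fin using (Fin; toℕ; punchIn)
open import Data.Nat as ℕ using (ℕ; zero; suc)
open import Data.Product using (Σ-syntax; ∃; ∃-syntax; _×_; _,_; proj₁; proj₂)
open import Data.Sum using (_⊎_)
open import Data.Vec.Functional using (Vector)
open import Function using (_∘_)
open import Level using (0ℓ)
open import Relation.Binary.PropositionalEquality using (_≡_; _≢_)
open import Relation.Binary.Structures using (IsStrictTotalOrder)
open import Relation.Nullary using (does)
open import Relation.Unary using (Pred; Satisfiable)
import Algebra.Properties.CommutativeMonoid.Sum as Sum

-- The classical real line: a Dedekind-complete ordered field (unique up to
-- isomorphism) with decidable order.  An exponential, to any base greater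
-- than 1, is carried along in order to define real powers; these do not
-- depend on the base.

record Reals : Set₁ where
  infix  8 -_
  infix  9 _⁻¹
  infixl 7 _*_
  infixl 6 _+_ _-_
  infixl 6 _⊓_
  infix  4 _<_ _≤_
  field
    Carrier : Set
    _+_ _*_ : Carrier → Carrier → Carrier
    -_ _⁻¹  : Carrier → Carrier
    0# 1#   : Carrier
    _<_     : Carrier → Carrier → Set

    isCommutativeRing  : IsCommutativeRing _≡_ _+_ _*_ -_ 0# 1#
    ⁻¹-inverseʳ        : ∀ x → x ≢ 0# → x * x ⁻¹ ≡ 1#
    isStrictTotalOrder : IsStrictTotalOrder _≡_ _<_
    0<1                : 0# < 1#
    +-monoˡ-<          : ∀ z {x y} → x < y → x + z < y + z
    *-pos              : ∀ {x y} → 0# < x → 0# < y → 0# < x * y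

  _≤_ : Carrier → Carrier → Set
  x ≤ y = x < y ⊎ x ≡ y

  UpperBound : Pred Carrier 0ℓ → Carrier → Set
  UpperBound P b = ∀ {x} → P x → x ≤ b

  field
    supremum : ∀ (P : Pred Carrier 0ℓ) → Satisfiable P → ∃ (UpperBound P) →
               ∃[ s ] UpperBound P s × (∀ {b} → UpperBound P b → s ≤ b)

    exp log    : Carrier → Carrier
    exp-pos    : ∀ x → 0# < exp x
    exp-+      : ∀ x y → exp (x + y) ≡ exp x * exp y
    exp-mono-< : ∀ {x y} → x < y → exp x < exp y
    exp-log    : ∀ {x} → 0# < x → exp (log x) ≡ x

  open IsStrictTotalOrder isStrictTotalOrder public using (_<?_; _≟_; compare)

  commutativeRing : CommutativeRing 0ℓ 0ℓ
  commutativeRing = record { isCommutativeRing = isCommutativeRing }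

  open Sum (CommutativeRing.+-commutativeMonoid commutativeRing) public using (sum)

  _-_ : Carrier → Carrier → Carrier
  x - y = x + - y

  _⊓_ : Carrier → Carrier → Carrier
  x ⊓ y = if does (x <? y) then x else y

  minimum : ∀ {m} → Vector Carrier (suc m) → Carrier
  minimum {zero}  v = v Fin.zero
  minimum {suc m} v = v Fin.zero ⊓ minimum (v ∘ Fin.suc)

  -- Used only for x ≥ 0 and a > 0, so that 0 ^ a is 0.
  infixr 8 _^_
  _^_ : Carrier → Carrier → Carrier
  x ^ a = if does (0# <? x) then exp (a * log x) else 0#

  √_ : Carrier → Carrier
  √ x = x ^ ((1# + 1#) ⁻¹)

module Dispersion (ℝ : Reals) (α : Reals.Carrier ℝ) where
  open Reals ℝ

  Point : Set
  Point = Carrier × Carrier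

  d : Point → Point → Carrier
  d (y₁ , y₂) (z₁ , z₂) = √ ((y₁ - z₁) * (y₁ - z₁) + (y₂ - z₂) * (y₂ - z₂))

  _≺_ : Point → Point → Set
  y ≺ z = proj₁ y < proj₁ z × proj₂ z < proj₂ y

  _𝓘_ : Point → Point → Set
  y 𝓘 z = y ≺ z ⊎ z ≺ y

  ParetoFront : ∀ {n} → Vector Point n → Set
  ParetoFront x = ∀ {i j} → i ≢ j → x i 𝓘 x j

  D : ∀ {n} (x : Vector Point n) (p : ℕ) → Vector Point p → Set
  D x p z = (∀ i → ∃[ j ] z i ≡ x j) × (∀ {i j} → i ≢ j → z i ≢ z j)

  -- punchIn i enumerates the indices different from i.  The problem is only
  -- posed for p ≥ 2, so the value of the last clause is irrelevant.
  maxSumMin : ∀ {p} → Vector Point p → Carrier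
  maxSumMin {suc (suc q)} z =
    sum (λ i → minimum (λ (j : Fin (suc q)) → d (z i) (z (punchIn i j)) ^ α))
  maxSumMin {_} _ = 0#

  Optimal : ∀ {n} (x : Vector Point n) (p : ℕ) → Vector Point p → Set
  Optimal x p z = D x p z × (∀ w → D x p w → maxSumMin w ≤ maxSumMin z)

-- Programs of a real RAM with separate integer and real memory cells.  The
-- input (n, p and the coordinates of the points) is read-only.  Programs are
-- pure syntax: they do not depend on the instance in any way.

infixl 7 _*ᶻ_ _*ʳ_ _/ʳ_
infixl 6 _+ᶻ_ _∸ᶻ_ _+ʳ_ _-ʳ_
infix  4 _<ᶻ_ _=ᶻ_ _<ʳ_ _=ʳ_
infix  3 int[_]≔_ real[_]≔_
infixr 2 _⨾_

data IntExpr : Set where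
  lit            : ℕ → IntExpr
  #points #chosen : IntExpr
  int[_]         : IntExpr → IntExpr
  _+ᶻ_ _∸ᶻ_ _*ᶻ_ : IntExpr → IntExpr → IntExpr

data RealExpr : Set where
  0ʳ 1ʳ               : RealExpr
  real[_]             : IntExpr → RealExpr
  x¹[_] x²[_]         : IntExpr → RealExpr
  _+ʳ_ _-ʳ_ _*ʳ_ _/ʳ_ : RealExpr → RealExpr → RealExpr
  distPow             : (y₁ y₂ z₁ z₂ : RealExpr) → RealExpr

data Test : Set where
  _<ᶻ_ _=ᶻ_ : IntExpr → IntExpr → Test
  _<ʳ_ _=ʳ_ : RealExpr → RealExpr → Test

data Program : Set where
  skip         : Program
  int[_]≔_     : IntExpr → IntExpr → Program
  real[_]≔_    : IntExpr → RealExpr → Program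
  _⨾_          : Program → Program → Program
  branch       : Test → Program → Program → Program
  while        : Test → Program → Program

costᶻ : IntExpr → ℕ
costᶻ (lit _)   = 1
costᶻ #points   = 1
costᶻ #chosen   = 1
costᶻ int[ a ]  = 1 ℕ.+ costᶻ a
costᶻ (a +ᶻ b)  = 1 ℕ.+ costᶻ a ℕ.+ costᶻ b
costᶻ (a ∸ᶻ b)  = 1 ℕ.+ costᶻ a ℕ.+ costᶻ b
costᶻ (a *ᶻ b)  = 1 ℕ.+ costᶻ a ℕ.+ costᶻ b

costʳ : RealExpr → ℕ
costʳ 0ʳ        = 1
costʳ 1ʳ        = 1
costʳ real[ a ] = 1 ℕ.+ costᶻ a
costʳ x¹[ a ]   = 1 ℕ.+ costᶻ a
costʳ x²[ a ]   = 1 ℕ.+ costᶻ a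
costʳ (r +ʳ s)  = 1 ℕ.+ costʳ r ℕ.+ costʳ s
costʳ (r -ʳ s)  = 1 ℕ.+ costʳ r ℕ.+ costʳ s
costʳ (r *ʳ s)  = 1 ℕ.+ costʳ r ℕ.+ costʳ s
costʳ (r /ʳ s)  = 1 ℕ.+ costʳ r ℕ.+ costʳ s
costʳ (distPow r s t u) = 1 ℕ.+ costʳ r ℕ.+ costʳ s ℕ.+ costʳ t ℕ.+ costʳ u

costᵗ : Test → ℕ
costᵗ (a <ᶻ b) = 1 ℕ.+ costᶻ a ℕ.+ costᶻ b
costᵗ (a =ᶻ b) = 1 ℕ.+ costᶻ a ℕ.+ costᶻ b
costᵗ (r <ʳ s) = 1 ℕ.+ costʳ r ℕ.+ costʳ s
costᵗ (r =ʳ s) = 1 ℕ.+ costʳ r ℕ.+ costʳ s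

-- Execution on a machine with M integer cells and M real cells, in which no
-- integer larger than W can be stored.  An execution that would read or write
-- outside these cells, store a larger integer, read a point that does not
-- exist or divide by zero has no derivation.

module Machine (ℝ : Reals) (α : Reals.Carrier ℝ) {n : ℕ} (p : ℕ)
               (x : Vector (Dispersion.Point ℝ α) n) (M W : ℕ) where
  open Reals ℝ
  open Dispersion ℝ α using (d)

  record Store : Set where
    constructor ⟨_,_⟩
    field
      ints  : ℕ → ℕ
      reals : ℕ → Carrier

  open Store public

  initial : Store
  initial = ⟨ (λ _ → 0) , (λ _ → 0#) ⟩

  update : {A : Set} → (ℕ → A) → ℕ → A → ℕ → A
  update f k v l = if does (l ℕ.≟ k) then v else f l

  infix 3 _⊢_⇓ᶻ_ _⊢_⇓ʳ_ _⊢_⇓ᵗ_ _⊢_⇓_after_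

  data _⊢_⇓ᶻ_ (σ : Store) : IntExpr → ℕ → Set where
    lit     : ∀ k → σ ⊢ lit k ⇓ᶻ k
    #points : σ ⊢ #points ⇓ᶻ n
    #chosen : σ ⊢ #chosen ⇓ᶻ p
    int     : ∀ {a k} → σ ⊢ a ⇓ᶻ k → k ℕ.< M → σ ⊢ int[ a ] ⇓ᶻ ints σ k
    _+ᶻ_    : ∀ {a b k l} → σ ⊢ a ⇓ᶻ k → σ ⊢ b ⇓ᶻ l → σ ⊢ a +ᶻ b ⇓ᶻ k ℕ.+ l
    _∸ᶻ_    : ∀ {a b k l} → σ ⊢ a ⇓ᶻ k → σ ⊢ b ⇓ᶻ l → σ ⊢ a ∸ᶻ b ⇓ᶻ k ℕ.∸ l
    _*ᶻ_    : ∀ {a b k l} → σ ⊢ a ⇓ᶻ k → σ ⊢ b ⇓ᶻ l → σ ⊢ a *ᶻ b ⇓ᶻ k ℕ.* l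

  data _⊢_⇓ʳ_ (σ : Store) : RealExpr → Carrier → Set where
    0ʳ      : σ ⊢ 0ʳ ⇓ʳ 0#
    1ʳ      : σ ⊢ 1ʳ ⇓ʳ 1#
    real    : ∀ {a k} → σ ⊢ a ⇓ᶻ k → k ℕ.< M → σ ⊢ real[ a ] ⇓ʳ reals σ k
    x¹[_]   : ∀ {a} {i : Fin n} → σ ⊢ a ⇓ᶻ toℕ i → σ ⊢ x¹[ a ] ⇓ʳ proj₁ (x i)
    x²[_]   : ∀ {a} {i : Fin n} → σ ⊢ a ⇓ᶻ toℕ i → σ ⊢ x²[ a ] ⇓ʳ proj₂ (x i)
    _+ʳ_    : ∀ {r s u v} → σ ⊢ r ⇓ʳ u → σ ⊢ s ⇓ʳ v → σ ⊢ r +ʳ s ⇓ʳ u + v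
    _-ʳ_    : ∀ {r s u v} → σ ⊢ r ⇓ʳ u → σ ⊢ s ⇓ʳ v → σ ⊢ r -ʳ s ⇓ʳ u - v
    _*ʳ_    : ∀ {r s u v} → σ ⊢ r ⇓ʳ u → σ ⊢ s ⇓ʳ v → σ ⊢ r *ʳ s ⇓ʳ u * v
    div     : ∀ {r s u v} → σ ⊢ r ⇓ʳ u → σ ⊢ s ⇓ʳ v → v ≢ 0# →
              σ ⊢ r /ʳ s ⇓ʳ u * v ⁻¹
    distPow : ∀ {r₁ r₂ s₁ s₂ y₁ y₂ z₁ z₂} →
              σ ⊢ r₁ ⇓ʳ y₁ → σ ⊢ r₂ ⇓ʳ y₂ → σ ⊢ s₁ ⇓ʳ z₁ → σ ⊢ s₂ ⇓ʳ z₂ →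
              σ ⊢ distPow r₁ r₂ s₁ s₂ ⇓ʳ d (y₁ , y₂) (z₁ , z₂) ^ α

  data _⊢_⇓ᵗ_ (σ : Store) : Test → Bool → Set where
    _<ᶻ_ : ∀ {a b k l} → σ ⊢ a ⇓ᶻ k → σ ⊢ b ⇓ᶻ l → σ ⊢ a <ᶻ b ⇓ᵗ does (k ℕ.<? l)
    _=ᶻ_ : ∀ {a b k l} → σ ⊢ a ⇓ᶻ k → σ ⊢ b ⇓ᶻ l → σ ⊢ a =ᶻ b ⇓ᵗ does (k ℕ.≟ l)
    _<ʳ_ : ∀ {r s u v} → σ ⊢ r ⇓ʳ u → σ ⊢ s ⇓ʳ v → σ ⊢ r <ʳ s ⇓ᵗ does (u <? v)
    _=ʳ_ : ∀ {r s u v} → σ ⊢ r ⇓ʳ u → σ ⊢ s ⇓ʳ v → σ ⊢ r =ʳ s ⇓ᵗ does (u ≟ v)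

  -- σ ⊢ P ⇓ σ′ after t: from σ, P halts in σ′ after t elementary operations.
  data _⊢_⇓_after_ (σ : Store) : Program → Store → ℕ → Set where
    skip     : σ ⊢ skip ⇓ σ after 1
    assignᶻ  : ∀ {a b k v} → σ ⊢ a ⇓ᶻ k → k ℕ.< M → σ ⊢ b ⇓ᶻ v → v ℕ.≤ W →
               σ ⊢ int[ a ]≔ b ⇓ ⟨ update (ints σ) k v , reals σ ⟩
                 after (1 ℕ.+ costᶻ a ℕ.+ costᶻ b)
    assignʳ  : ∀ {a r k v} → σ ⊢ a ⇓ᶻ k → k ℕ.< M → σ ⊢ r ⇓ʳ v →
               σ ⊢ real[ a ]≔ r ⇓ ⟨ ints σ , update (reals σ) k v ⟩
                 after (1 ℕ.+ costᶻ a ℕ.+ costʳ r)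
    _⨾_      : ∀ {P Q σ′ σ″ t t′} → σ ⊢ P ⇓ σ′ after t → σ′ ⊢ Q ⇓ σ″ after t′ →
               σ ⊢ P ⨾ Q ⇓ σ″ after (t ℕ.+ t′)
    branch-true  : ∀ {b P Q σ′ t} → σ ⊢ b ⇓ᵗ true → σ ⊢ P ⇓ σ′ after t →
                   σ ⊢ branch b P Q ⇓ σ′ after (1 ℕ.+ costᵗ b ℕ.+ t)
    branch-false : ∀ {b P Q σ′ t} → σ ⊢ b ⇓ᵗ false → σ ⊢ Q ⇓ σ′ after t →
                   σ ⊢ branch b P Q ⇓ σ′ after (1 ℕ.+ costᵗ b ℕ.+ t)
    while-true  : ∀ {b P σ′ σ″ t t′} → σ ⊢ b ⇓ᵗ true → σ ⊢ P ⇓ σ′ after t →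
                  σ′ ⊢ while b P ⇓ σ″ after t′ →
                  σ ⊢ while b P ⇓ σ″ after (1 ℕ.+ costᵗ b ℕ.+ t ℕ.+ t′)
    while-false : ∀ {b P} → σ ⊢ b ⇓ᵗ false →
                  σ ⊢ while b P ⇓ σ after (1 ℕ.+ costᵗ b)

module Complexity (ℝ : Reals) (α : Reals.Carrier ℝ) where
  open Reals ℝ using (Carrier)
  open Dispersion ℝ α

  -- The indices of an optimal selection are returned in the integer cells
  -- 0, …, p-1 and the optimal value in the real cell 0; the cells of the
  -- output count as memory.
  SolvesWithin : Program → (n p time memory word : ℕ) → Set
  SolvesWithin P n p time memory word =
    p ℕ.≤ memory ×
    (∀ (x : Vector Point n) → ParetoFront x →
     let open Machine ℝ α p x memory word in
     ∃[ σ ] ∃[ t ] (initial ⊢ P ⇓ σ after t) × t ℕ.≤ time ×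
     Σ[ s ∈ Vector (Fin n) p ]
       (∀ i → ints σ (toℕ i) ≡ toℕ (s i)) ×
       Optimal x p (x ∘ s) ×
       reals σ 0 ≡ maxSumMin (x ∘ s))

  -- One program solves all instances with 2 ≤ p ≤ n and Case p in time
  -- O(time n p) and memory O(memory n p).  Stored integers are polynomially
  -- bounded in n, i.e. words have O(log n) bits, so that a single cell cannot
  -- encode a whole table.
  SolvableIn : (Case : ℕ → Set) (time memory : ℕ → ℕ → ℕ) → Set
  SolvableIn Case time memory =
    ∃[ P ] ∃[ c ] ∃[ k ] (∀ n p → 2 ℕ.≤ p → p ℕ.≤ n → Case p →
      SolvesWithin P n p (c ℕ.* time n p) (c ℕ.* memory n p) (c ℕ.* n ℕ.^ k))

  PolynomiallySolvable : Set
  PolynomiallySolvable =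
    ∃[ k ] SolvableIn (2 ℕ.≤_) (λ n p → n ℕ.^ k) (λ n p → n ℕ.^ k)

{-# OPTIONS --safe #-}
module Submission where

-- Along a Pareto front distances grow with the interval spanned, so in a chain
-- z₁ ≺ … ≺ z_p the nearest point to zᵢ is zᵢ₋₁ or zᵢ₊₁ and the objective is
--   f(z₁,z₂) + Σ min(f(zᵢ₋₁,zᵢ), f(zᵢ,zᵢ₊₁)) + f(z_{p-1},z_p),  f = d^α.
-- Moving z₁ and z_p to the extreme points of E does not decrease it; hence for
-- fixed p it suffices to enumerate the other p - 2 points.  In general the best
-- continuation of a chain depends only on its last two points and the number of
-- points still missing, which gives a recursion over p n² states with n choices
-- each.  Both programs compare first coordinates instead of sorting E; values
-- are nonnegative, so -1 can mark infeasible choices.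

open import Defs
open import Algebra.Bundles using (CommutativeRing)
open import Data.Bool using (if_then_else_)
open import Data.Fin using (Fin; zero; suc; toℕ; fromℕ<; inject≤; punchIn; punchOut)
open import Data.Fin.Permutation
  using (Permutation′; _⟨$⟩ʳ_; _⟨$⟩ˡ_; flip; inverseˡ; inverseʳ; insert; insert-punchIn)
  renaming (id to idᵖ)
open import Data.Fin.Properties as Fin
  using (punchIn-punchOut; punchInᵢ≢i; punchIn-injective; toℕ-fromℕ<; inject≤-injective)
open import Data.Nat as ℕ using (ℕ; zero; suc; z≤n; s≤s)
open import Data.Nat.DivMod using (_%_; [m+kn]%n≡m%n; m<n⇒m%n≡m)
import Data.Nat.Properties as ℕ
open import Data.Nat.Solver using (module +-*-Solver)
open import Data.Product using (Σ-syntax; ∃-syntax; _×_; _,_; proj₁; proj₂)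
open import Data.Sum using (_⊎_; inj₁; inj₂; [_,_]′)
open import Data.Unit using (⊤; tt)
open import Data.Vec.Functional using (Vector)
open import Function using (_∘_; Injective)
open import Relation.Binary using (tri<; tri≈; tri>)
open import Relation.Binary.Bundles using (StrictTotalOrder)
open import Relation.Binary.PropositionalEquality
open import Relation.Nullary using (¬_; Dec; yes; no; does; contradiction)
open import Relation.Nullary.Decidable using (True; toWitness; dec-true; dec-false)
import Algebra.Properties.AbelianGroup as AbelianGroupProperties
import Algebra.Properties.CommutativeMonoid.Sum as Sum
import Algebra.Properties.Ring as RingProperties
import Relation.Binary.Properties.StrictTotalOrder as StrictTotalOrderProperties

-- Ordered fields

-- The contribution of a point is settled only once both of its neighbours are known. Hence a
-- partial solution is described by two adjacent points, and `tailVal` leaves out the contribution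
-- of its first point. The objective is defined on unordered tuples with minima over all other
-- indices, so every selection is first replaced by its sorted form, which has the same value.
-- Asymptotic constants come from the program text: a run takes at most `size P * suc T` steps,
-- where `suc T` bounds the product of the lengths of nested loops. The exhaustive search therefore
-- unrolls everything whose length depends only on p, and its constant memory consists of two chains
-- and a counter. The bound on words is respected because table addresses occur only inside
-- expressions; what is stored are point indices and counters, which never exceed n.

module OrderedField (ℝ : Reals) where
  open Reals ℝ

  open CommutativeRing commutativeRing public
    using (+-comm; +-assoc; +-identityˡ; +-identityʳ; -‿inverseʳ; *-comm; distribʳ;
           zeroʳ)
  open RingProperties (CommutativeRing.ring commutativeRing) public
    using (-‿distribˡ-*; -‿distribʳ-*; -‿involutive)
  open AbelianGroupProperties (CommutativeRing.+-abelianGroup commutativeRing) public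
    using (⁻¹-anti-homo‿-)

  strictTotalOrder : StrictTotalOrder _ _ _
  strictTotalOrder = record { isStrictTotalOrder = isStrictTotalOrder }

  open StrictTotalOrder strictTotalOrder public
    using () renaming (trans to <-trans; irrefl to <-irrefl; asym to <-asym)
  open StrictTotalOrderProperties strictTotalOrder public
    using () renaming (refl to ≤-refl; trans to ≤-trans; antisym to ≤-antisym)

  ≮⇒≥ : ∀ {x y} → ¬ x < y → y ≤ x
  ≮⇒≥ {x} {y} x≮y with compare x y
  ... | tri< x<y _ _  = contradiction x<y x≮y
  ... | tri≈ _ x≡y _  = inj₂ (sym x≡y)
  ... | tri> _ _ y<x  = inj₁ y<x

  ≤⇒≯ : ∀ {x y} → x ≤ y → ¬ y < x
  ≤⇒≯ (inj₁ x<y) y<x = <-asym x<y y<x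
  ≤⇒≯ (inj₂ x≡y) y<x = <-irrefl (sym x≡y) y<x

  <-≤-trans : ∀ {x y z} → x < y → y ≤ z → x < z
  <-≤-trans x<y (inj₁ y<z) = <-trans x<y y<z
  <-≤-trans x<y (inj₂ refl) = x<y

  +-monoʳ-< : ∀ z {x y} → x < y → z + x < z + y
  +-monoʳ-< z {x} {y} x<y = subst₂ _<_ (+-comm x z) (+-comm y z) (+-monoˡ-< z x<y)

  +-mono-≤ : ∀ {x y u v} → x ≤ y → u ≤ v → x + u ≤ y + v
  +-mono-≤ {x} {y} {u} {v} x≤y u≤v = ≤-trans (left x≤y) (right u≤v)
    where
    left : x ≤ y → x + u ≤ y + u
    left (inj₁ x<y) = inj₁ (+-monoˡ-< u x<y)
    left (inj₂ x≡y) = inj₂ (cong (_+ u) x≡y)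
    right : u ≤ v → y + u ≤ y + v
    right (inj₁ u<v) = inj₁ (+-monoʳ-< y u<v)
    right (inj₂ u≡v) = inj₂ (cong (y +_) u≡v)

  +-nonneg : ∀ {x y} → 0# ≤ x → 0# ≤ y → 0# ≤ x + y
  +-nonneg 0≤x 0≤y = subst (_≤ _) (+-identityʳ 0#) (+-mono-≤ 0≤x 0≤y)

  y-x+x≡y : ∀ x y → y - x + x ≡ y
  y-x+x≡y x y = begin
    y + - x + x    ≡⟨ +-assoc y (- x) x ⟩
    y + (- x + x)  ≡⟨ cong (y +_) (trans (+-comm (- x) x) (-‿inverseʳ x)) ⟩
    y + 0#         ≡⟨ +-identityʳ y ⟩
    y              ∎
    where open ≡-Reasoning

  x<y⇒0<y-x : ∀ {x y} → x < y → 0# < y - x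
  x<y⇒0<y-x {x} {y} x<y = subst (_< y - x) (-‿inverseʳ x) (+-monoˡ-< (- x) x<y)

  0<y-x⇒x<y : ∀ {x y} → 0# < y - x → x < y
  0<y-x⇒x<y {x} {y} 0<y-x =
    subst₂ _<_ (+-identityˡ x) (y-x+x≡y x y) (+-monoˡ-< x 0<y-x)

  neg-mono-< : ∀ {x y} → x < y → - y < - x
  neg-mono-< {x} {y} x<y = 0<y-x⇒x<y (subst (0# <_) y-x≡-x--y (x<y⇒0<y-x x<y))
    where
    y-x≡-x--y : y - x ≡ - x - - y
    y-x≡-x--y = trans (+-comm y (- x)) (cong (- x +_) (sym (-‿involutive y)))

  *-monoˡ-< : ∀ {x y z} → 0# < z → x < y → x * z < y * z
  *-monoˡ-< {x} {y} {z} 0<z x<y =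
    0<y-x⇒x<y (subst (0# <_) distrib (*-pos (x<y⇒0<y-x x<y) 0<z))
    where
    distrib : (y - x) * z ≡ y * z - x * z
    distrib = trans (distribʳ z y (- x)) (cong (y * z +_) (sym (-‿distribˡ-* x z)))

  *-monoʳ-< : ∀ {x y z} → 0# < z → x < y → z * x < z * y
  *-monoʳ-< {x} {y} {z} 0<z x<y = subst₂ _<_ (*-comm x z) (*-comm y z) (*-monoˡ-< 0<z x<y)

  square-mono-< : ∀ {x y} → 0# < x → x < y → x * x < y * y
  square-mono-< 0<x x<y = <-trans (*-monoˡ-< 0<x x<y) (*-monoʳ-< (<-trans 0<x x<y) x<y)

  square-diff-sym : ∀ x y → (x - y) * (x - y) ≡ (y - x) * (y - x)
  square-diff-sym x y = begin
    (x - y) * (x - y)        ≡⟨ cong₂ _*_ x-y≡ x-y≡ ⟩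
    - (y - x) * - (y - x)    ≡⟨ -‿distribˡ-* (y - x) (- (y - x)) ⟨
    - ((y - x) * - (y - x))  ≡⟨ cong -_ (-‿distribʳ-* (y - x) (y - x)) ⟨
    - - ((y - x) * (y - x))  ≡⟨ -‿involutive _ ⟩
    (y - x) * (y - x)        ∎
    where
    open ≡-Reasoning
    x-y≡ : x - y ≡ - (y - x)
    x-y≡ = sym (⁻¹-anti-homo‿- y x)

  square-diff-monoʳ : ∀ {x y z} → x < y → y < z → (x - y) * (x - y) < (x - z) * (x - z)
  square-diff-monoʳ {x} {y} {z} x<y y<z =
    subst₂ _<_ (square-diff-sym y x) (square-diff-sym z x)
      (square-mono-< (x<y⇒0<y-x x<y) (+-monoˡ-< (- x) y<z))

  square-diff-monoˡ : ∀ {x y z} → x < y → y < z → (y - z) * (y - z) < (x - z) * (x - z)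
  square-diff-monoˡ {x} {y} {z} x<y y<z =
    subst₂ _<_ (square-diff-sym z y) (square-diff-sym z x)
      (square-mono-< (x<y⇒0<y-x y<z) (+-monoʳ-< z (neg-mono-< x<y)))

  0<2 : 0# < 1# + 1#
  0<2 = <-trans 0<1 (subst (_< 1# + 1#) (+-identityˡ 1#) (+-monoˡ-< 1# 0<1))

  -- The square root is defined as a power with this exponent, so its monotonicity needs the
  -- exponent to be positive. The other two cases contradict `2 * half = 1`.
  0<half : 0# < (1# + 1#) ⁻¹
  0<half with compare 0# ((1# + 1#) ⁻¹)
  ... | tri< 0<h _ _ = 0<h
  ... | tri≈ _ 0≡h _ = contradiction 0<1 (<-irrefl
    (trans (sym (zeroʳ (1# + 1#))) (trans (cong ((1# + 1#) *_) 0≡h) 2*half≡1)))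
    where
    2*half≡1 : (1# + 1#) * (1# + 1#) ⁻¹ ≡ 1#
    2*half≡1 = ⁻¹-inverseʳ (1# + 1#) λ 2≡0 → <-irrefl (sym 2≡0) 0<2
  ... | tri> _ _ h<0 = contradiction 0<1 (<-asym (subst₂ _<_
    (⁻¹-inverseʳ (1# + 1#) λ 2≡0 → <-irrefl (sym 2≡0) 0<2)
    (zeroʳ (1# + 1#)) (*-monoʳ-< 0<2 h<0)))

  -1<0 : 0# - 1# < 0#
  -1<0 = subst (0# - 1# <_) (-‿inverseʳ 1#) (+-monoˡ-< (- 1#) 0<1)

  log-mono-< : ∀ {x y} → 0# < x → x < y → log x < log y
  log-mono-< {x} {y} 0<x x<y with compare (log x) (log y)
  ... | tri< lx<ly _ _ = lx<ly
  ... | tri≈ _ lx≡ly _ = contradiction x<y (<-irrefl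
    (trans (sym (exp-log 0<x)) (trans (cong exp lx≡ly) (exp-log (<-trans 0<x x<y)))))
  ... | tri> _ _ ly<lx = contradiction x<y (<-asym
    (subst₂ _<_ (exp-log (<-trans 0<x x<y)) (exp-log 0<x) (exp-mono-< ly<lx)))

  ^-nonneg : ∀ x a → 0# ≤ x ^ a
  ^-nonneg x a with 0# <? x
  ... | yes _ = inj₁ (exp-pos _)
  ... | no  _ = inj₂ refl

  -- A base that is not positive has power 0 by definition of `_^_`, and exponentials are positive,
  -- so no sign condition on the bases arises.
  ^-monoˡ-≤ : ∀ {x y a} → 0# < a → x ≤ y → x ^ a ≤ y ^ a
  ^-monoˡ-≤ 0<a (inj₂ refl) = inj₂ refl
  ^-monoˡ-≤ {x} {y} {a} 0<a (inj₁ x<y) with 0# <? x | 0# <? y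
  ... | yes 0<x | yes _   = inj₁ (exp-mono-< (*-monoʳ-< 0<a (log-mono-< 0<x x<y)))
  ... | yes 0<x | no  0≮y = contradiction (<-trans 0<x x<y) 0≮y
  ... | no  _   | yes _   = inj₁ (exp-pos _)
  ... | no  _   | no  _   = inj₂ refl

  ⊓-< : ∀ {x y} → x < y → x ⊓ y ≡ x
  ⊓-< {x} {y} x<y with x <? y
  ... | yes _   = refl
  ... | no  x≮y = contradiction x<y x≮y

  ⊓-≮ : ∀ {x y} → ¬ x < y → x ⊓ y ≡ y
  ⊓-≮ {x} {y} x≮y with x <? y
  ... | yes x<y = contradiction x<y x≮y
  ... | no  _   = refl

  x⊓y≤x : ∀ x y → x ⊓ y ≤ x
  x⊓y≤x x y with x <? y
  ... | yes _   = inj₂ refl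
  ... | no  x≮y = ≮⇒≥ x≮y

  x⊓y≤y : ∀ x y → x ⊓ y ≤ y
  x⊓y≤y x y with x <? y
  ... | yes x<y = inj₁ x<y
  ... | no  _   = inj₂ refl

  ⊓-glb : ∀ {x y z} → z ≤ x → z ≤ y → z ≤ x ⊓ y
  ⊓-glb {x} {y} z≤x z≤y with x <? y
  ... | yes _ = z≤x
  ... | no  _ = z≤y

  ⊓-mono-≤ : ∀ {x y u v} → x ≤ y → u ≤ v → x ⊓ u ≤ y ⊓ v
  ⊓-mono-≤ {x} {u = u} x≤y u≤v =
    ⊓-glb (≤-trans (x⊓y≤x x u) x≤y) (≤-trans (x⊓y≤y x u) u≤v)

  minimum-≤ : ∀ {m} (v : Vector Carrier (suc m)) i → minimum v ≤ v i
  minimum-≤ {zero}  v zero    = ≤-refl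
  minimum-≤ {suc m} v zero    = x⊓y≤x _ _
  minimum-≤ {suc m} v (suc i) = ≤-trans (x⊓y≤y _ _) (minimum-≤ (v ∘ suc) i)

  minimum-glb : ∀ {m} (v : Vector Carrier (suc m)) {b} → (∀ i → b ≤ v i) → b ≤ minimum v
  minimum-glb {zero}  v b≤v = b≤v zero
  minimum-glb {suc m} v b≤v = ⊓-glb (b≤v zero) (minimum-glb (v ∘ suc) (b≤v ∘ suc))

-- Chains

-- Selections are sequences ℕ → Fin n of which only an initial segment matters,
-- so that programs can address their entries by natural numbers.

infixr 5 _◂_
_◂_ : {A : Set} → A → (ℕ → A) → ℕ → A
(a ◂ s) zero    = a
(a ◂ s) (suc m) = s m

extend : ∀ {A : Set} {m} → Vector A (suc m) → ℕ → A
extend         v zero    = v zero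
extend {m = zero}  v (suc _) = v zero
extend {m = suc m} v (suc l) = extend (v ∘ suc) l

extend-toℕ : ∀ {A : Set} {m} (v : Vector A (suc m)) i → extend v (toℕ i) ≡ v i
extend-toℕ         v zero    = refl
extend-toℕ {m = suc m} v (suc i) = extend-toℕ (v ∘ suc) i

-- Advances a loop invariant about all indices below the counter: an index is either already covered
-- or the current one.
toℕ-<suc : ∀ {n} {i j : Fin n} → toℕ i ℕ.< suc (toℕ j) → toℕ i ℕ.< toℕ j ⊎ i ≡ j
toℕ-<suc i<1+j with ℕ.m≤n⇒m<n∨m≡n (ℕ.≤-pred i<1+j)
... | inj₁ i<j = inj₁ i<j
... | inj₂ i≡j = inj₂ (Fin.toℕ-injective i≡j)

-- Finite maxima with default value -1

module Maximum (ℝ : Reals) where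
  open Reals ℝ
  open OrderedField ℝ

  -1# : Carrier
  -1# = 0# - 1#

  infixl 6 _⊔_
  _⊔_ : Carrier → Carrier → Carrier
  x ⊔ y = if does (x <? y) then y else x

  x≤x⊔y : ∀ x y → x ≤ x ⊔ y
  x≤x⊔y x y with x <? y
  ... | yes x<y = inj₁ x<y
  ... | no  _   = ≤-refl

  y≤x⊔y : ∀ x y → y ≤ x ⊔ y
  y≤x⊔y x y with x <? y
  ... | yes _   = ≤-refl
  ... | no  x≮y = ≮⇒≥ x≮y

  ⊔-sel : ∀ x y → x ⊔ y ≡ x ⊎ x ⊔ y ≡ y
  ⊔-sel x y with x <? y
  ... | yes _ = inj₂ refl
  ... | no  _ = inj₁ refl

  maximum : ∀ {m} → Vector Carrier m → Carrier
  maximum {zero}  v = -1#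
  maximum {suc m} v = maximum (v ∘ suc) ⊔ v zero

  -1≤maximum : ∀ {m} (v : Vector Carrier m) → -1# ≤ maximum v
  -1≤maximum {zero}  v = ≤-refl
  -1≤maximum {suc m} v = ≤-trans (-1≤maximum (v ∘ suc)) (x≤x⊔y _ _)

  ≤maximum : ∀ {m} (v : Vector Carrier m) i → v i ≤ maximum v
  ≤maximum v zero    = y≤x⊔y _ _
  ≤maximum v (suc i) = ≤-trans (≤maximum (v ∘ suc) i) (x≤x⊔y _ _)

  Attained : ∀ {m} → Vector Carrier m → Carrier → Set
  Attained v b = b ≡ -1# ⊎ ∃[ i ] b ≡ v i

  maximum-attained : ∀ {m} (v : Vector Carrier m) → Attained v (maximum v)
  maximum-attained {zero}  v = inj₁ refl
  maximum-attained {suc m} v with ⊔-sel (maximum (v ∘ suc)) (v zero)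
  ... | inj₂ eq = inj₂ (zero , eq)
  ... | inj₁ eq with maximum-attained (v ∘ suc)
  ...   | inj₁ eq′       = inj₁ (trans eq eq′)
  ...   | inj₂ (i , eq′) = inj₂ (suc i , trans eq eq′)

  -- The search loop visits the indices in the order opposite to the recursion of `maximum`. Bounds
  -- and attainment characterise the result without comparing the two orders.
  maximum-unique : ∀ {m} (v : Vector Carrier m) {b} →
                   -1# ≤ b → (∀ i → v i ≤ b) → Attained v b → b ≡ maximum v
  maximum-unique v {b} -1≤b v≤b attained = ≤-antisym (below attained) (above (maximum-attained v))
    where
    below : Attained v b → b ≤ maximum v
    below (inj₁ refl)       = -1≤maximum v
    below (inj₂ (i , refl)) = ≤maximum v i
    above : Attained v (maximum v) → maximum v ≤ b
    above (inj₁ eq)       = subst (_≤ b) (sym eq) -1≤b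
    above (inj₂ (i , eq)) = subst (_≤ b) (sym eq) (v≤b i)

module Chains (ℝ : Reals) (α : Reals.Carrier ℝ) (0<α : Reals._<_ ℝ (Reals.0# ℝ) α)
              {n : ℕ} (x : Vector (Dispersion.Point ℝ α) n)
              (pareto : Dispersion.ParetoFront ℝ α x) where
  open Reals ℝ
  open Dispersion ℝ α
  open OrderedField ℝ
  open Maximum ℝ
  open Sum (CommutativeRing.+-commutativeMonoid commutativeRing) using (sum-permute; sum-cong-≗)

  f : Fin n → Fin n → Carrier
  f i j = d (x i) (x j) ^ α

  infix 4 _◁_
  _◁_ : Fin n → Fin n → Set
  i ◁ j = proj₁ (x i) < proj₁ (x j)

  ◁⇒≺ : ∀ {i j} → i ◁ j → x i ≺ x j
  ◁⇒≺ {i} {j} i◁j with pareto {i} {j} (λ i≡j → <-irrefl (cong (proj₁ ∘ x) i≡j) i◁j)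
  ... | inj₁ xi≺xj = xi≺xj
  ... | inj₂ xj≺xi = contradiction (proj₁ xj≺xi) (<-asym i◁j)

  ◁-connex : ∀ {i j} → i ≢ j → ¬ j ◁ i → i ◁ j
  ◁-connex i≢j j⋪i with pareto i≢j
  ... | inj₁ xi≺xj = proj₁ xi≺xj
  ... | inj₂ xj≺xi = contradiction (proj₁ xj≺xi) j⋪i

  0≤f : ∀ i j → 0# ≤ f i j
  0≤f i j = ^-nonneg _ α

  f-sym : ∀ i j → f i j ≡ f j i
  f-sym i j = cong (λ s → (√ s) ^ α)
    (cong₂ _+_ (square-diff-sym (proj₁ (x i)) (proj₁ (x j)))
               (square-diff-sym (proj₂ (x i)) (proj₂ (x j))))

  -- Widening an interval of the front enlarges both squared coordinate differences. Second
  -- coordinates decrease along the front, so their part uses the mirrored inequality.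
  f-monoʳ : ∀ {i j k} → i ◁ j → j ◁ k → f i j ≤ f i k
  f-monoʳ i◁j j◁k = ^-monoˡ-≤ 0<α (^-monoˡ-≤ 0<half (+-mono-≤
    (inj₁ (square-diff-monoʳ i◁j j◁k))
    (inj₁ (subst₂ _<_ (square-diff-sym _ _) (square-diff-sym _ _)
      (square-diff-monoˡ (proj₂ (◁⇒≺ j◁k)) (proj₂ (◁⇒≺ i◁j)))))))

  f-monoˡ : ∀ {i j k} → i ◁ j → j ◁ k → f j k ≤ f i k
  f-monoˡ i◁j j◁k = ^-monoˡ-≤ 0<α (^-monoˡ-≤ 0<half (+-mono-≤
    (inj₁ (square-diff-monoˡ i◁j j◁k))
    (inj₁ (subst₂ _<_ (square-diff-sym _ _) (square-diff-sym _ _)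
      (square-diff-monoʳ (proj₂ (◁⇒≺ j◁k)) (proj₂ (◁⇒≺ i◁j)))))))

  Sel : Set
  Sel = ℕ → Fin n

  -- Here `k` counts the points beyond the two that every selection has: the chain is `s 0`, ...,
  -- `s (1 + k)`, so p is `2 + k` and there are `1 + k` steps.
  Chain : ℕ → Sel → Set
  Chain k s = ∀ m → m ℕ.≤ k → s m ◁ s (suc m)

  chain-tail : ∀ {k s} → Chain (suc k) s → Chain k (s ∘ suc)
  chain-tail c m m≤k = c (suc m) (s≤s m≤k)

  chain-cons : ∀ {k i s} → i ◁ s 0 → Chain k s → Chain (suc k) (i ◂ s)
  chain-cons i◁s c zero    _         = i◁s
  chain-cons i◁s c (suc m) (s≤s m≤k) = c m m≤k

  chain-< : ∀ {k s} → Chain k s → ∀ {l m} → l ℕ.< m → m ℕ.≤ suc k → s l ◁ s m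
  chain-< c {l} {suc m} l<1+m 1+m≤1+k with ℕ.m≤n⇒m<n∨m≡n (ℕ.≤-pred l<1+m)
  ... | inj₁ l<m  = <-trans (chain-< c l<m (ℕ.<⇒≤ 1+m≤1+k)) (c m (ℕ.≤-pred 1+m≤1+k))
  ... | inj₂ refl = c l (ℕ.≤-pred 1+m≤1+k)

  -- The contributions of all points of a chain of k + 2 points but the first.
  tailVal : ℕ → Sel → Carrier
  tailVal zero    s = f (s 0) (s 1)
  tailVal (suc k) s = f (s 0) (s 1) ⊓ f (s 1) (s 2) + tailVal k (s ∘ suc)

  chainVal : ℕ → Sel → Carrier
  chainVal k s = f (s 0) (s 1) + tailVal k s

  0≤tailVal : ∀ k s → 0# ≤ tailVal k s
  0≤tailVal zero    s = 0≤f _ _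
  0≤tailVal (suc k) s = +-nonneg (⊓-glb (0≤f _ _) (0≤f _ _)) (0≤tailVal k (s ∘ suc))

  0≤chainVal : ∀ k s → 0# ≤ chainVal k s
  0≤chainVal k s = +-nonneg (0≤f _ _) (0≤tailVal k s)

  tailVal-cong : ∀ k {s s′} → (∀ m → m ℕ.≤ suc k → s m ≡ s′ m) → tailVal k s ≡ tailVal k s′
  tailVal-cong zero    eq = cong₂ f (eq 0 z≤n) (eq 1 (s≤s z≤n))
  tailVal-cong (suc k) eq = cong₂ _+_
    (cong₂ _⊓_ (cong₂ f (eq 0 z≤n) (eq 1 (s≤s z≤n))) (cong₂ f (eq 1 (s≤s z≤n)) (eq 2 (s≤s (s≤s z≤n)))))
    (tailVal-cong k (λ m m≤ → eq (suc m) (s≤s m≤)))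

  chainVal-cong : ∀ k {s s′} → (∀ m → m ℕ.≤ suc k → s m ≡ s′ m) → chainVal k s ≡ chainVal k s′
  chainVal-cong k eq = cong₂ _+_ (cong₂ f (eq 0 z≤n) (eq 1 (s≤s z≤n))) (tailVal-cong k eq)

  -- The objective on chains and under reordering

  distances : ∀ {q} → Vector Point (2 ℕ.+ q) → Fin (2 ℕ.+ q) → Vector Carrier (suc q)
  distances z i j = d (z i) (z (punchIn i j)) ^ α

  nearest : ∀ {q} → Vector Point (2 ℕ.+ q) → Fin (2 ℕ.+ q) → Carrier
  nearest z i = minimum (distances z i)

  points : ∀ {p} → Sel → Vector Point p
  points s = x ∘ s ∘ toℕ

  nearest-first : ∀ k {s} → Chain k s → nearest {k} (points s) zero ≡ f (s 0) (s 1)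
  nearest-first k {s} c = ≤-antisym (minimum-≤ v zero) (minimum-glb v far)
    where
    v = distances {k} (points s) zero
    far : ∀ j → f (s 0) (s 1) ≤ v j
    far zero    = ≤-refl
    far (suc j) = f-monoʳ (c 0 z≤n) (chain-< c (s≤s (s≤s z≤n)) (Fin.toℕ<n (suc j)))

  -- `s 0` is at least as far from `s (2 + i)` as `s 1` is, so dropping the head leaves this minimum
  -- unchanged. The sum can thus be evaluated by recursion on the tail.
  nearest-later : ∀ k {s} → Chain (suc k) s → ∀ i →
                  nearest {suc k} (points s) (suc (suc i)) ≡ nearest {k} (points (s ∘ suc)) (suc i)
  nearest-later k {s} c i = ≤-antisym (x⊓y≤y _ _) (⊓-glb further ≤-refl)
    where
    i′ = suc (toℕ i)
    further : nearest {k} (points (s ∘ suc)) (suc i) ≤ f (s (suc i′)) (s 0)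
    further = ≤-trans (minimum-≤ (distances {k} (points (s ∘ suc)) (suc i)) zero)
      (subst₂ _≤_ (f-sym _ _) (f-sym _ _)
        (f-monoˡ (c 0 z≤n) (chain-< c (s≤s (s≤s z≤n)) (Fin.toℕ<n (suc i)))))

  maxSumMin-chain : ∀ k {s} → Chain k s → maxSumMin {2 ℕ.+ k} (points s) ≡ chainVal k s
  maxSumMin-chain k {s} c = cong₂ _+_ (nearest-first k c) (rest k c)
    where
    rest : ∀ k {s} → Chain k s → sum (nearest {k} (points s) ∘ suc) ≡ tailVal k s
    rest zero    {s} c = trans (+-identityʳ _) (f-sym _ _)
    rest (suc k) {s} c = cong₂ _+_
      -- The minimum at the second point splits off its distance to `s 0`; what remains is the
      -- minimum at the first point of the tail.
      (cong₂ _⊓_ (f-sym _ _) (nearest-first k (chain-tail c)))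
      (trans (sum-cong-≗ (nearest-later k c)) (rest k (chain-tail c)))

  -- Each distance from `z i` reappears among those from `w (π i)`, at the index given by
  -- `punchOut`. The reverse inequality comes from the inverse permutation.
  nearest-rearrange : ∀ {q} (z w : Vector Point (2 ℕ.+ q)) (π : Permutation′ (2 ℕ.+ q)) →
                      (∀ i → z i ≡ w (π ⟨$⟩ʳ i)) → ∀ i → nearest w (π ⟨$⟩ʳ i) ≤ nearest z i
  nearest-rearrange z w π z≡wπ i = minimum-glb (distances z i) λ j →
    let πi≢ : π ⟨$⟩ʳ i ≢ π ⟨$⟩ʳ punchIn i j
        πi≢ = λ eq → punchInᵢ≢i i j
          (sym (trans (sym (inverseˡ π)) (trans (cong (π ⟨$⟩ˡ_) eq) (inverseˡ π))))
    in subst (nearest w (π ⟨$⟩ʳ i) ≤_)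
         (cong₂ (λ y y′ → d y y′ ^ α) (sym (z≡wπ i))
           (trans (cong w (punchIn-punchOut πi≢)) (sym (z≡wπ (punchIn i j)))))
         (minimum-≤ (distances w (π ⟨$⟩ʳ i)) (punchOut πi≢))

  maxSumMin-rearrange : ∀ {q} (z w : Vector Point (2 ℕ.+ q)) (π : Permutation′ (2 ℕ.+ q)) →
                        (∀ i → z i ≡ w (π ⟨$⟩ʳ i)) → maxSumMin z ≡ maxSumMin w
  maxSumMin-rearrange z w π z≡wπ =
    trans (sum-cong-≗ λ i → ≤-antisym (converse i) (nearest-rearrange z w π z≡wπ i))
          (sym (sum-permute (nearest w) π))
    where
    converse : ∀ i → nearest z i ≤ nearest w (π ⟨$⟩ʳ i)
    converse i = subst (λ j → nearest z j ≤ nearest w (π ⟨$⟩ʳ i)) (inverseˡ π)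
      (nearest-rearrange w z (flip π) (λ j → trans (cong w (sym (inverseʳ π))) (sym (z≡wπ (π ⟨$⟩ˡ j))))
        (π ⟨$⟩ʳ i))

  leftmost : ∀ {m} (u : Vector (Fin n) (suc m)) → ∃[ k ] ∀ i → ¬ u i ◁ u k
  leftmost {zero}  u = zero , λ { zero → <-irrefl refl }
  leftmost {suc m} u with leftmost (u ∘ suc)
  ... | k , least with proj₁ (x (u zero)) <? proj₁ (x (u (suc k)))
  ...   | yes u₀◁uₖ = zero , λ { zero → <-irrefl refl ; (suc i) uᵢ◁u₀ → least i (<-trans uᵢ◁u₀ u₀◁uₖ) }
  ...   | no  u₀⋪uₖ = suc k , λ { zero → u₀⋪uₖ ; (suc i) → least i }

  -- Selection sort: `insert zero k π` puts the leftmost entry first and orders the others,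
  -- addressed through `punchIn k`, recursively. Injectivity turns the weak comparison with the
  -- leftmost entry into a strict one.
  sort : ∀ {m} (u : Vector (Fin n) m) → Injective _≡_ _≡_ u →
         Σ[ π ∈ Permutation′ m ] ∀ (i j : Fin m) → toℕ i ℕ.< toℕ j → u (π ⟨$⟩ʳ i) ◁ u (π ⟨$⟩ʳ j)
  sort {zero}  u inj = idᵖ , λ ()
  sort {suc m} u inj with leftmost u
  ... | k , least with sort (u ∘ punchIn k) (punchIn-injective k _ _ ∘ inj)
  ...   | π , sorted = insert zero k π , sorted′
    where
    sorted′ : ∀ i j → toℕ i ℕ.< toℕ j → u (insert zero k π ⟨$⟩ʳ i) ◁ u (insert zero k π ⟨$⟩ʳ j)
    sorted′ zero (suc j) _ = subst (λ l → u k ◁ u l) (sym (insert-punchIn zero k π j))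
      (◁-connex (λ eq → punchInᵢ≢i k _ (sym (inj eq))) (least _))
    sorted′ (suc i) (suc j) (s≤s i<j) =
      subst₂ (λ l l′ → u l ◁ u l′) (sym (insert-punchIn zero k π i)) (sym (insert-punchIn zero k π j))
        (sorted i j i<j)

  extend-chain : ∀ k (v : Vector (Fin n) (2 ℕ.+ k)) →
                 (∀ (i j : Fin (2 ℕ.+ k)) → toℕ i ℕ.< toℕ j → v i ◁ v j) → Chain k (extend v)
  extend-chain k v sorted m m≤k = subst₂ _◁_ (value i (toℕ-fromℕ< m<)) (value j (toℕ-fromℕ< 1+m<))
    (sorted i j (subst₂ ℕ._<_ (sym (toℕ-fromℕ< m<)) (sym (toℕ-fromℕ< 1+m<)) ℕ.≤-refl))
    where
    1+m< : suc m ℕ.< 2 ℕ.+ k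
    1+m< = s≤s (s≤s m≤k)
    m< : m ℕ.< 2 ℕ.+ k
    m< = ℕ.<⇒≤ 1+m<
    i = fromℕ< m<
    j = fromℕ< 1+m<
    value : ∀ i {l} → toℕ i ≡ l → v i ≡ extend v l
    value i refl = sym (extend-toℕ v i)

  -- Distinct points have distinct indices, so these can be sorted. This reduces optimality over all
  -- selections to optimality over chains.
  sortSelection : ∀ k {w} → D x (2 ℕ.+ k) w →
                  ∃[ s ] Chain k s × chainVal k s ≡ maxSumMin w
  sortSelection k {w} (w∈E , w-distinct) =
    s , chain , trans (sym (maxSumMin-chain k chain)) (maxSumMin-rearrange (points s) w π s≡wπ)
    where
    u : Vector (Fin n) (2 ℕ.+ k)
    u i = proj₁ (w∈E i)
    u-injective : Injective _≡_ _≡_ u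
    u-injective {i} {j} eq with i Fin.≟ j
    ... | yes i≡j = i≡j
    ... | no  i≢j = contradiction
      (trans (proj₂ (w∈E i)) (trans (cong x eq) (sym (proj₂ (w∈E j))))) (w-distinct i≢j)
    sorting = sort u u-injective
    π = proj₁ sorting
    v : Vector (Fin n) (2 ℕ.+ k)
    v i = u (π ⟨$⟩ʳ i)
    s = extend v
    chain : Chain k s
    chain = extend-chain k v (proj₂ sorting)
    s≡wπ : ∀ i → points s i ≡ w (π ⟨$⟩ʳ i)
    s≡wπ i = trans (cong x (extend-toℕ v i)) (sym (proj₂ (w∈E (π ⟨$⟩ʳ i))))

  -- Sorting the first `2 + k` points gives one. Its nonnegative value shows that no search can end
  -- with its initial value -1.
  chain-exists : ∀ k → 2 ℕ.+ k ℕ.≤ n → ∃[ s ] Chain k s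
  chain-exists k p≤n = let s , c , _ = sortSelection k {w} (w∈E , distinct) in s , c
    where
    w : Vector Point (2 ℕ.+ k)
    w i = x (inject≤ i p≤n)
    w∈E : ∀ i → ∃[ j ] w i ≡ x j
    w∈E i = inject≤ i p≤n , refl
    distinct : ∀ {i j} → i ≢ j → w i ≢ w j
    distinct {i} {j} i≢j eq with pareto (i≢j ∘ inject≤-injective p≤n p≤n i j)
    ... | inj₁ wi≺wj = <-irrefl (cong proj₁ eq) (proj₁ wi≺wj)
    ... | inj₂ wj≺wi = <-irrefl (cong proj₁ (sym eq)) (proj₁ wj≺wi)

  chain-distinct : ∀ k {s} → Chain k s → ∀ (i j : Fin (2 ℕ.+ k)) → i ≢ j → points {2 ℕ.+ k} s i ≢ points {2 ℕ.+ k} s j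
  chain-distinct k {s} c i j i≢j eq with ℕ.<-cmp (toℕ i) (toℕ j)
  ... | tri< i<j _ _ = <-irrefl (cong proj₁ eq) (chain-< c i<j (ℕ.≤-pred (Fin.toℕ<n j)))
  ... | tri≈ _ i≡j _ = i≢j (Fin.toℕ-injective i≡j)
  ... | tri> _ _ j<i = <-irrefl (cong proj₁ (sym eq)) (chain-< c j<i (ℕ.≤-pred (Fin.toℕ<n i)))

  optimal-chain : ∀ k {s} → Chain k s → (∀ s′ → Chain k s′ → chainVal k s′ ≤ chainVal k s) →
                  Optimal x (2 ℕ.+ k) (points s)
  optimal-chain k {s} c best =
    ((λ i → s (toℕ i) , refl) , λ {i} {j} → chain-distinct k c i j) , maximal
    where
    maximal : ∀ w → D x (2 ℕ.+ k) w → maxSumMin w ≤ maxSumMin {2 ℕ.+ k} (points s)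
    maximal w w∈D =
      let s′ , c′ , eq = sortSelection k w∈D
      in ≤-trans (inj₂ (sym eq)) (≤-trans (best s′ c′) (inj₂ (sym (maxSumMin-chain k c))))

  -- Position `1 + k` is the end of a chain of `2 + k` points; later positions are irrelevant. The
  -- recursion runs parallel to that of `tailVal`.
  setLast : ℕ → Fin n → Sel → Sel
  setLast k       r s zero    = s zero
  setLast zero    r s (suc m) = r
  setLast (suc k) r s (suc m) = setLast k r (s ∘ suc) m

  setLast-last : ∀ k r s → setLast k r s (suc k) ≡ r
  setLast-last zero    r s = refl
  setLast-last (suc k) r s = setLast-last k r (s ∘ suc)

  module _ {r : Fin n} (rightmost : ∀ i → ¬ r ◁ i) where

    ◁-rightmost : ∀ {i j} → i ◁ j → i ◁ r
    ◁-rightmost {i} {j} i◁j = ◁-connex (λ { refl → rightmost j i◁j }) (rightmost i)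

    f-≤rightmost : ∀ {i j} → i ◁ j → f i j ≤ f i r
    f-≤rightmost {i} {j} i◁j with j Fin.≟ r
    ... | yes refl = ≤-refl
    ... | no  j≢r  = f-monoʳ i◁j (◁-connex j≢r (rightmost j))

    setLast-chain : ∀ k {s} → Chain k s → Chain k (setLast k r s)
    setLast-chain zero    c zero    _         = ◁-rightmost (c 0 z≤n)
    setLast-chain (suc k) c zero    _         = c 0 z≤n
    setLast-chain (suc k) c (suc m) (s≤s m≤k) = setLast-chain k (chain-tail c) m m≤k

    first-≤setLast : ∀ k {s} → Chain k s →
                     f (s 0) (s 1) ≤ f (s 0) (setLast k r s 1)
    first-≤setLast zero    c = f-≤rightmost (c 0 z≤n)
    first-≤setLast (suc k) c = ≤-refl

    -- With at least three points the last one is neither of the first two, so in the leading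
    -- summand only the second argument of the minimum can change, and it grows.
    tailVal-≤setLast : ∀ k {s} → Chain k s → tailVal k s ≤ tailVal k (setLast k r s)
    tailVal-≤setLast zero    c = first-≤setLast zero c
    tailVal-≤setLast (suc k) c = +-mono-≤
      (⊓-mono-≤ ≤-refl (first-≤setLast k (chain-tail c)))
      (tailVal-≤setLast k (chain-tail c))

    chainVal-≤setLast : ∀ k {s} → Chain k s → chainVal k s ≤ chainVal k (setLast k r s)
    chainVal-≤setLast k c = +-mono-≤ (first-≤setLast k c) (tailVal-≤setLast k c)

  module _ {l : Fin n} (least : ∀ i → ¬ i ◁ l) where

    ◁-leftmost : ∀ {i j} → i ◁ j → l ◁ j
    ◁-leftmost {i} {j} i◁j = ◁-connex (λ { refl → least i i◁j }) (least j)

    f-≤leftmost : ∀ {i j} → i ◁ j → f i j ≤ f l j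
    f-≤leftmost {i} {j} i◁j with l Fin.≟ i
    ... | yes refl = ≤-refl
    ... | no  l≢i  = f-monoˡ (◁-connex l≢i (least i)) i◁j

    setFirst-chain : ∀ k {s} → Chain k s → Chain k (l ◂ s ∘ suc)
    setFirst-chain k c zero    0≤k = ◁-leftmost (c 0 0≤k)
    setFirst-chain k c (suc m) m<k = c (suc m) m<k

    chainVal-≤setFirst : ∀ k {s} → Chain k s → chainVal k s ≤ chainVal k (l ◂ s ∘ suc)
    chainVal-≤setFirst zero    c = +-mono-≤ (f-≤leftmost (c 0 z≤n)) (f-≤leftmost (c 0 z≤n))
    chainVal-≤setFirst (suc k) c = +-mono-≤ (f-≤leftmost (c 0 z≤n))
      (+-mono-≤ (⊓-mono-≤ (f-≤leftmost (c 0 z≤n)) ≤-refl) ≤-refl)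

  widen : ∀ {l r} → (∀ i → ¬ i ◁ l) → (∀ i → ¬ r ◁ i) → ∀ k {s} → Chain k s →
          ∃[ s′ ] Chain k s′ × s′ 0 ≡ l × s′ (suc k) ≡ r × chainVal k s ≤ chainVal k s′
  widen {l} {r} least rightmost k {s} c =
    (l ◂ setLast k r s ∘ suc) , setFirst-chain least k c′ , refl , setLast-last k r s ,
    ≤-trans (chainVal-≤setLast rightmost k c) (chainVal-≤setFirst least k c′)
    where
    c′ = setLast-chain rightmost k c

  -- The value of prepending a point that contributes c to a partial selection
  -- of value v starting with j ◁ h; the value -1 stands for infeasibility.
  feasible : Fin n → Fin n → Carrier → Carrier → Carrier
  feasible j h c v =
    if does (proj₁ (x j) <? proj₁ (x h)) then
      (if does (v <? 0#) then -1# else c + v)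
    else -1#

  feasible-≡ : ∀ {j h c v} → j ◁ h → 0# ≤ v → feasible j h c v ≡ c + v
  feasible-≡ {j} {h} {c} {v} j◁h 0≤v with proj₁ (x j) <? proj₁ (x h) | v <? 0#
  ... | yes _   | yes v<0 = contradiction v<0 (≤⇒≯ 0≤v)
  ... | yes _   | no  _   = refl
  ... | no  j⋪h | _       = contradiction j◁h j⋪h

  -- Failure is encoded by a negative number only, so a nonnegative result certifies that both tests
  -- succeeded.
  feasible-sound : ∀ {j h c v} → 0# ≤ feasible j h c v →
                   j ◁ h × 0# ≤ v × feasible j h c v ≡ c + v
  feasible-sound {j} {h} {c} {v} 0≤ with proj₁ (x j) <? proj₁ (x h) | v <? 0#
  ... | yes _   | yes _   = contradiction -1<0 (≤⇒≯ 0≤)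
  ... | yes j◁h | no  v≮0 = j◁h , ≮⇒≥ v≮0 , refl
  ... | no  _   | _       = contradiction -1<0 (≤⇒≯ 0≤)

  feasible-≮ : ∀ {j h c v} → ¬ j ◁ h → feasible j h c v ≡ -1#
  feasible-≮ {j} {h} j⋪h with proj₁ (x j) <? proj₁ (x h)
  ... | yes j◁h = contradiction j◁h j⋪h
  ... | no  _   = refl

  feasible-neg : ∀ {j h c v} → v < 0# → feasible j h c v ≡ -1#
  feasible-neg {j} {h} {c} {v} v<0 with proj₁ (x j) <? proj₁ (x h) | v <? 0#
  ... | yes _ | yes _   = refl
  ... | yes _ | no  v≮0 = contradiction v<0 v≮0
  ... | no  _ | _       = refl

  -- V k i j is the largest tailVal k of a chain starting with i and j, or -1 if
  -- there is none.
  V : ℕ → Fin n → Fin n → Carrier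
  V zero    i j = f i j
  V (suc k) i j = maximum (λ h → feasible j h (f i j ⊓ f j h) (V k j h))

  tailVal≤V : ∀ k {s} → Chain k s → tailVal k s ≤ V k (s 0) (s 1)
  tailVal≤V zero    c = ≤-refl
  tailVal≤V (suc k) {s} c =
    ≤-trans (+-mono-≤ ≤-refl below)
      (subst (_≤ V (suc k) (s 0) (s 1))
        (feasible-≡ (c 1 (s≤s z≤n)) (≤-trans (0≤tailVal k _) below))
        (≤maximum (λ h → feasible (s 1) h (f (s 0) (s 1) ⊓ f (s 1) h) (V k (s 1) h)) (s 2)))
    where
    below : tailVal k (s ∘ suc) ≤ V k (s 1) (s 2)
    below = tailVal≤V k (chain-tail c)

  -- `a` is the table's record of a maximizing `h`. An infeasible entry has no meaningful maximizer,
  -- so nothing is required of it.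
  Witness : ℕ → Fin n → Fin n → ℕ → Set
  Witness k i j a = 0# ≤ V (suc k) i j →
    ∃[ h ] a ≡ toℕ h × V (suc k) i j ≡ feasible j h (f i j ⊓ f j h) (V k j h)

  -- Following the recorded maximizers rebuilds a chain that attains `V k i j`. `V` leaves the test
  -- of `i ◁ j` to the user of the entry, hence that hypothesis; `feasible-sound` supplies both
  -- hypotheses for the next pair. The last component lists the table reads that `reconstruct`
  -- performs, with `k ∸ m` points still missing at position `m`.
  trace : (arg : ℕ → Fin n → Fin n → ℕ) → ∀ k → (∀ m → m ℕ.< k → ∀ i j → Witness m i j (arg (suc m) i j)) →
          ∀ {i j} → i ◁ j → 0# ≤ V k i j →
          ∃[ s ] s 0 ≡ i × s 1 ≡ j × Chain k s × tailVal k s ≡ V k i j ×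
                 (∀ m → m ℕ.< k → arg (k ℕ.∸ m) (s m) (s (suc m)) ≡ toℕ (s (2 ℕ.+ m)))
  trace arg zero    wit {i} {j} i◁j 0≤V =
    (i ◂ λ _ → j) , refl , refl , (λ { zero _ → i◁j }) , refl , λ _ ()
  trace arg (suc k) wit {i} {j} i◁j 0≤V with wit k ℕ.≤-refl i j 0≤V
  ... | h , a≡h , V≡ with feasible-sound (subst (0# ≤_) V≡ 0≤V)
  ...   | j◁h , 0≤V′ , feas≡ with trace arg k (λ m m<k → wit m (ℕ.m≤n⇒m≤1+n m<k)) j◁h 0≤V′
  ...     | s , refl , refl , c , val , args =
    (i ◂ s) , refl , refl , chain-cons i◁j c ,
    trans (cong (f i (s 0) ⊓ f (s 0) (s 1) +_) val) (sym (trans V≡ feas≡)) , args′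
    where
    args′ : ∀ m → m ℕ.< suc k →
            arg (suc k ℕ.∸ m) ((i ◂ s) m) ((i ◂ s) (suc m)) ≡ toℕ ((i ◂ s) (2 ℕ.+ m))
    args′ zero    _         = a≡h
    args′ (suc m) (s≤s m<k) = args m m<k

-- Program logic

-- Bounds the time of a program in which every loop runs at most once.
size : Program → ℕ
size skip           = 1
size (int[ a ]≔ b)  = 1 ℕ.+ costᶻ a ℕ.+ costᶻ b
size (real[ a ]≔ r) = 1 ℕ.+ costᶻ a ℕ.+ costʳ r
size (P ⨾ Q)        = size P ℕ.+ size Q
size (branch b P Q) = 1 ℕ.+ costᵗ b ℕ.+ (size P ℕ.+ size Q)
size (while b P)    = 1 ℕ.+ costᵗ b ℕ.+ (1 ℕ.+ costᵗ b ℕ.+ size P)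

for : (counter bound : IntExpr) → Program → Program
for c e P = int[ c ]≔ lit 0 ⨾ while (int[ c ] <ᶻ e) (P ⨾ int[ c ]≔ int[ c ] +ᶻ lit 1)

δ : IntExpr → IntExpr → RealExpr
δ a b = distPow x¹[ a ] x²[ a ] x¹[ b ] x²[ b ]

module Logic (ℝ : Reals) (α : Reals.Carrier ℝ) {n : ℕ} (p : ℕ)
             (x : Vector (Dispersion.Point ℝ α) n) (M W : ℕ) where
  open Reals ℝ using (Carrier; _^_; _<?_)
  open Dispersion ℝ α using (d)
  open Machine ℝ α p x M W public

  setInt : ℕ → ℕ → Store → Store
  setInt k v σ = ⟨ update (ints σ) k v , reals σ ⟩

  setReal : ℕ → Carrier → Store → Store
  setReal k v σ = ⟨ ints σ , update (reals σ) k v ⟩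

  update-same : ∀ {A : Set} (g : ℕ → A) k v → update g k v k ≡ v
  update-same g k v rewrite dec-true (k ℕ.≟ k) refl = refl

  update-other : ∀ {A : Set} (g : ℕ → A) {k l} v → l ≢ k → update g k v l ≡ g l
  update-other g {k} {l} v l≢k rewrite dec-false (l ℕ.≟ k) l≢k = refl

  -- Bounding by 1 + T instead of T avoids side conditions that T is positive.
  record Runs (T : ℕ) (P : Program) (Q : Store → Set) (σ : Store) : Set where
    constructor runs
    field
      {final} : Store
      {steps} : ℕ
      exec    : σ ⊢ P ⇓ final after steps
      time    : steps ℕ.≤ size P ℕ.* suc T
      post    : Q final

  m≤m*1+T : ∀ m T → m ℕ.≤ m ℕ.* suc T
  m≤m*1+T m T = ℕ.m≤m*n m (suc T)

  runs-post : ∀ {T P Q Q′ σ} → (∀ σ′ → Q σ′ → Q′ σ′) → Runs T P Q σ → Runs T P Q′ σ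
  runs-post imp (runs e t q) = runs e t (imp _ q)

  runs-skip : ∀ {T Q σ} → Q σ → Runs T skip Q σ
  runs-skip {T} q = runs skip (m≤m*1+T 1 T) q

  runs-int : ∀ {T Q σ a b k v} → σ ⊢ a ⇓ᶻ k → k ℕ.< M → σ ⊢ b ⇓ᶻ v → v ℕ.≤ W →
             Q (setInt k v σ) → Runs T (int[ a ]≔ b) Q σ
  runs-int {T} a k<M b v≤W q = runs (assignᶻ a k<M b v≤W) (m≤m*1+T _ T) q

  runs-real : ∀ {T Q σ a r k v} → σ ⊢ a ⇓ᶻ k → k ℕ.< M → σ ⊢ r ⇓ʳ v →
              Q (setReal k v σ) → Runs T (real[ a ]≔ r) Q σ
  runs-real {T} a k<M r q = runs (assignʳ a k<M r) (m≤m*1+T _ T) q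

  -- The postcondition of the first program is that the second one runs, so proofs follow the
  -- program text without naming intermediate states. Both times share the factor `suc T`, so sizes
  -- just add.
  runs-seq : ∀ {T P P′ Q σ} → Runs T P (Runs T P′ Q) σ → Runs T (P ⨾ P′) Q σ
  runs-seq {T} {P} {P′} (runs e t (runs e′ t′ q)) =
    runs (e ⨾ e′)
         (ℕ.≤-trans (ℕ.+-mono-≤ t t′) (ℕ.≤-reflexive (sym (ℕ.*-distribʳ-+ (suc T) (size P) (size P′)))))
         q

  runs-branch : ∀ {T Q σ b P P′} {A : Set} (A? : Dec A) → σ ⊢ b ⇓ᵗ does A? →
                (A → Runs T P Q σ) → (¬ A → Runs T P′ Q σ) → Runs T (branch b P P′) Q σ
  runs-branch {T} {b = b} {P} {P′} (yes a) test then else with then a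
  ... | runs e t q = runs (branch-true test e) (begin
    1 ℕ.+ costᵗ b ℕ.+ _                                    ≤⟨ ℕ.+-mono-≤ (m≤m*1+T _ T) t ⟩
    (1 ℕ.+ costᵗ b) ℕ.* suc T ℕ.+ size P ℕ.* suc T         ≡⟨ ℕ.*-distribʳ-+ (suc T) (1 ℕ.+ costᵗ b) (size P) ⟨
    (1 ℕ.+ costᵗ b ℕ.+ size P) ℕ.* suc T                   ≤⟨ ℕ.*-monoˡ-≤ (suc T) (ℕ.+-monoʳ-≤ (1 ℕ.+ costᵗ b) (ℕ.m≤m+n _ _)) ⟩
    (1 ℕ.+ costᵗ b ℕ.+ (size P ℕ.+ size P′)) ℕ.* suc T     ∎) q
    where open ℕ.≤-Reasoning
  runs-branch {T} {b = b} {P} {P′} (no ¬a) test then else with else ¬a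
  ... | runs e t q = runs (branch-false test e) (begin
    1 ℕ.+ costᵗ b ℕ.+ _                                    ≤⟨ ℕ.+-mono-≤ (m≤m*1+T _ T) t ⟩
    (1 ℕ.+ costᵗ b) ℕ.* suc T ℕ.+ size P′ ℕ.* suc T        ≡⟨ ℕ.*-distribʳ-+ (suc T) (1 ℕ.+ costᵗ b) (size P′) ⟨
    (1 ℕ.+ costᵗ b ℕ.+ size P′) ℕ.* suc T                  ≤⟨ ℕ.*-monoˡ-≤ (suc T) (ℕ.+-monoʳ-≤ (1 ℕ.+ costᵗ b) (ℕ.m≤n+m _ _)) ⟩
    (1 ℕ.+ costᵗ b ℕ.+ (size P ℕ.+ size P′)) ℕ.* suc T     ∎) q
    where open ℕ.≤-Reasoning

  -- The loop rule. `N` passes, each within factor `suc T`, fit into the factor `suc T′`; `size`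
  -- counts the test twice, for the passes and for the exit. The counter ends at `N`, which
  -- therefore must fit into a word.
  module _ {T T′ N k : ℕ} {c e : IntExpr} {P : Program} (Inv : ℕ → Store → Set)
           (counter : ∀ σ → σ ⊢ c ⇓ᶻ k) (k<M : k ℕ.< M)
           (bound : ∀ σ → σ ⊢ e ⇓ᶻ N) (N≤W : N ℕ.≤ W) (fits : N ℕ.* suc T ℕ.≤ suc T′)
           (body : ∀ t σ → t ℕ.< N → ints σ k ≡ t → Inv t σ →
                   Runs T P (λ σ′ → ints σ′ k ≡ t × Inv (suc t) (setInt k (suc t) σ′)) σ)
           where

    private
      b = int[ c ] <ᶻ e
      test = 1 ℕ.+ costᵗ b
      P⁺ = P ⨾ int[ c ]≔ int[ c ] +ᶻ lit 1
      pass = (test ℕ.+ size P⁺) ℕ.* suc T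

      test⇓ : ∀ σ → σ ⊢ b ⇓ᵗ does (ints σ k ℕ.<? N)
      test⇓ σ = int (counter σ) k<M <ᶻ bound σ

      iterate : ∀ r t σ → t ℕ.+ r ≡ N → ints σ k ≡ t → Inv t σ →
                Σ[ σ′ ∈ Store ] Σ[ s ∈ ℕ ]
                  (σ ⊢ while b P⁺ ⇓ σ′ after s) × s ℕ.≤ r ℕ.* pass ℕ.+ test × Inv N σ′
      iterate zero t σ t+0≡N eq inv =
        σ , test ,
        while-false (subst (σ ⊢ b ⇓ᵗ_) (dec-false (ints σ k ℕ.<? N) done) (test⇓ σ)) ,
        ℕ.≤-refl , subst (λ m → Inv m σ) t≡N inv
        where
        t≡N = trans (sym (ℕ.+-identityʳ t)) t+0≡N
        done : ¬ ints σ k ℕ.< N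
        done lt = ℕ.<-irrefl (trans eq t≡N) lt
      iterate (suc r) t σ t+r≡N eq inv with body t σ t<N eq inv
        where
        t<N : t ℕ.< N
        t<N = subst (t ℕ.<_) t+r≡N (ℕ.m<m+n t (s≤s z≤n))
      ... | runs {σ₁} {s₁} exec₁ time₁ (eq₁ , inv₁)
        with iterate r (suc t) (setInt k (suc t) σ₁) (trans (sym (ℕ.+-suc t r)) t+r≡N)
                     (update-same (ints σ₁) k (suc t)) inv₁
      ...   | σ₂ , s₂ , exec₂ , time₂ , inv₂ =
        σ₂ , _ ,
        while-true (subst (σ ⊢ b ⇓ᵗ_) (dec-true (ints σ k ℕ.<? N) (subst (ℕ._< N) (sym eq) t<N)) (test⇓ σ))
                   (exec₁ ⨾ increment) exec₂ ,
        (begin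
          test ℕ.+ (s₁ ℕ.+ inc) ℕ.+ s₂
            ≤⟨ ℕ.+-mono-≤ (ℕ.+-mono-≤ (m≤m*1+T test T) (ℕ.+-mono-≤ time₁ (m≤m*1+T inc T))) time₂ ⟩
          test ℕ.* suc T ℕ.+ (size P ℕ.* suc T ℕ.+ inc ℕ.* suc T) ℕ.+ (r ℕ.* pass ℕ.+ test)
            ≡⟨ solve 6 (λ a b c u r p → a :* u :+ (b :* u :+ c :* u) :+ (r :+ p)
                                     := (a :+ (b :+ c)) :* u :+ r :+ p)
                     refl test (size P) inc (suc T) (r ℕ.* pass) test ⟩
          suc r ℕ.* pass ℕ.+ test ∎) ,
        inv₂
        where
        open ℕ.≤-Reasoning
        open +-*-Solver
        inc = size (int[ c ]≔ int[ c ] +ᶻ lit 1)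
        t<N : t ℕ.< N
        t<N = subst (t ℕ.<_) t+r≡N (ℕ.m<m+n t (s≤s z≤n))
        next : σ₁ ⊢ int[ c ] +ᶻ lit 1 ⇓ᶻ suc t
        next = subst (σ₁ ⊢ int[ c ] +ᶻ lit 1 ⇓ᶻ_) (trans (cong (ℕ._+ 1) eq₁) (ℕ.+-comm t 1))
                     (int (counter σ₁) k<M +ᶻ lit 1)
        increment : σ₁ ⊢ int[ c ]≔ int[ c ] +ᶻ lit 1 ⇓ setInt k (suc t) σ₁ after inc
        increment = assignᶻ (counter σ₁) k<M next (ℕ.≤-trans t<N N≤W)

    runs-for : ∀ {Q σ} → Inv 0 (setInt k 0 σ) → (∀ σ′ → Inv N σ′ → Q σ′) →
               Runs T′ (for c e P) Q σ
    runs-for {σ = σ} inv q with iterate N 0 (setInt k 0 σ) refl (update-same (ints σ) k 0) inv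
    ... | σ′ , s , exec , time , inv′ =
      runs (assignᶻ (counter σ) k<M (lit 0) z≤n ⨾ exec)
        (begin
          init ℕ.+ s
            ≤⟨ ℕ.+-monoʳ-≤ init time ⟩
          init ℕ.+ (N ℕ.* pass ℕ.+ test)
            ≡⟨ cong (λ m → init ℕ.+ (m ℕ.+ test))
                 (solve 3 (λ a b c → a :* (b :* c) := b :* (a :* c)) refl N (test ℕ.+ size P⁺) (suc T)) ⟩
          init ℕ.+ ((test ℕ.+ size P⁺) ℕ.* (N ℕ.* suc T) ℕ.+ test)
            ≤⟨ ℕ.+-mono-≤ (m≤m*1+T init T′)
                 (ℕ.+-mono-≤ (ℕ.*-monoʳ-≤ (test ℕ.+ size P⁺) fits) (m≤m*1+T test T′)) ⟩
          init ℕ.* suc T′ ℕ.+ ((test ℕ.+ size P⁺) ℕ.* suc T′ ℕ.+ test ℕ.* suc T′)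
            ≡⟨ solve 4 (λ a b c u → a :* u :+ (b :* u :+ c :* u) := (a :+ (c :+ b)) :* u)
                     refl init (test ℕ.+ size P⁺) test (suc T′) ⟩
          size (for c e P) ℕ.* suc T′ ∎)
        (q σ′ inv′)
      where
      open ℕ.≤-Reasoning
      open +-*-Solver
      init = size (int[ c ]≔ lit 0)

  runs-forPoints : ∀ {T T′ k c P} (Inv : ℕ → Store → Set) →
    (∀ σ → σ ⊢ c ⇓ᶻ k) → k ℕ.< M → n ℕ.≤ W → n ℕ.* suc T ℕ.≤ suc T′ →
    (∀ (i : Fin n) σ → ints σ k ≡ toℕ i → Inv (toℕ i) σ →
     Runs T P (λ σ′ → ints σ′ k ≡ toℕ i × Inv (suc (toℕ i)) (setInt k (suc (toℕ i)) σ′)) σ) →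
    ∀ {Q σ} → Inv 0 (setInt k 0 σ) → (∀ σ′ → Inv n σ′ → Q σ′) →
    Runs T′ (for c #points P) Q σ
  runs-forPoints {T} {T′} {k} {c} {P} Inv counter k<M n≤W fits body =
    runs-for Inv counter k<M (λ _ → #points) n≤W fits λ t σ t<n →
      subst (λ t → ints σ k ≡ t → Inv t σ →
                   Runs T P (λ σ′ → ints σ′ k ≡ t × Inv (suc t) (setInt k (suc t) σ′)) σ)
            (toℕ-fromℕ< t<n) (body (fromℕ< t<n) σ)

  read : ∀ {σ k v} → k ℕ.< M → ints σ k ≡ v → σ ⊢ int[ lit k ] ⇓ᶻ v
  read k<M refl = int (lit _) k<M

  readʳ : ∀ {σ k} → k ℕ.< M → σ ⊢ real[ lit k ] ⇓ʳ reals σ k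
  readʳ k<M = real (lit _) k<M

  δ⇓ : ∀ {σ a b} {i j : Fin n} → σ ⊢ a ⇓ᶻ toℕ i → σ ⊢ b ⇓ᶻ toℕ j →
       σ ⊢ δ a b ⇓ʳ d (x i) (x j) ^ α
  δ⇓ a b = distPow x¹[ a ] x²[ a ] x¹[ b ] x²[ b ]

module Solution
  (ℝ : Reals) (α : Reals.Carrier ℝ) (0<α : Reals._<_ ℝ (Reals.0# ℝ) α)
  {n : ℕ} (q : ℕ) (x : Vector (Dispersion.Point ℝ α) n)
  (pareto : Dispersion.ParetoFront ℝ α x) (M W : ℕ) where

  open Reals ℝ using (_≤_)
  open Dispersion ℝ α using (Optimal; maxSumMin)
  open Chains ℝ α 0<α x pareto
  open Logic ℝ α (2 ℕ.+ q) x M W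

  Solved : Store → Set
  Solved σ = ∃[ s ] Chain q s × (∀ m → m ℕ.< 2 ℕ.+ q → ints σ m ≡ toℕ (s m)) ×
                    reals σ 0 ≡ chainVal q s × (∀ s′ → Chain q s′ → chainVal q s′ ≤ chainVal q s)

  solved : ∀ {T P time} → Runs T P Solved initial → size P ℕ.* suc T ℕ.≤ time →
    ∃[ σ ] ∃[ t ] (initial ⊢ P ⇓ σ after t) × t ℕ.≤ time ×
      Σ[ s ∈ Vector (Fin n) (2 ℕ.+ q) ]
        (∀ i → ints σ (toℕ i) ≡ toℕ (s i)) ×
        Optimal x (2 ℕ.+ q) (x ∘ s) ×
        reals σ 0 ≡ maxSumMin (x ∘ s)
  solved (runs {σ} {t} exec t≤ (s , chain , outputs , value , best)) time≤ =
    σ , t , exec , ℕ.≤-trans t≤ time≤ ,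
    s ∘ toℕ , (λ i → outputs (toℕ i) (Fin.toℕ<n i)) , optimal-chain q chain best ,
    trans value (sym (maxSumMin-chain q chain))

-- Dynamic programming

m*b+r<a*b : ∀ {m a r b} → m ℕ.< a → r ℕ.< b → m ℕ.* b ℕ.+ r ℕ.< a ℕ.* b
m*b+r<a*b {m} {a} {r} {b} m<a r<b = begin-strict
  m ℕ.* b ℕ.+ r  <⟨ ℕ.+-monoʳ-< (m ℕ.* b) r<b ⟩
  m ℕ.* b ℕ.+ b  ≡⟨ ℕ.+-comm (m ℕ.* b) b ⟩
  suc m ℕ.* b    ≤⟨ ℕ.*-monoˡ-≤ b m<a ⟩
  a ℕ.* b        ∎
  where open ℕ.≤-Reasoning

-- Reduction modulo `b` recovers the last digit. Applied twice, this shows that different table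
-- entries have different addresses.
*+-injective : ∀ {b m m′ r r′} → r ℕ.< b → r′ ℕ.< b →
               m ℕ.* b ℕ.+ r ≡ m′ ℕ.* b ℕ.+ r′ → m ≡ m′ × r ≡ r′
*+-injective {b} {m} {m′} {r} {r′} r<b r′<b eq = ℕ.*-cancelʳ-≡ m m′ b mb≡m′b , r≡r′
  where
  instance b≢0 = ℕ.>-nonZero (ℕ.≤-<-trans z≤n r<b)
  remainder : ∀ m {r} → r ℕ.< b → (m ℕ.* b ℕ.+ r) % b ≡ r
  remainder m {r} r<b = trans (cong (_% b) (ℕ.+-comm (m ℕ.* b) r))
                              (trans ([m+kn]%n≡m%n r m b) (m<n⇒m%n≡m r<b))
  r≡r′ : r ≡ r′
  r≡r′ = trans (sym (remainder m r<b)) (trans (cong (_% b) eq) (remainder m′ r′<b))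
  mb≡m′b : m ℕ.* b ≡ m′ ℕ.* b
  mb≡m′b = ℕ.+-cancelʳ-≡ r (m ℕ.* b) (m′ ℕ.* b) (trans eq (cong (m′ ℕ.* b ℕ.+_) (sym r≡r′)))

-- Integer cells 0 and 1 hold the best pair of first points found so far, cells
-- 2 to 5 the loop counters k, i, j and h, and cell 6 the best successor h.  The
-- real cells 0 and 1 hold the corresponding best values, and cell 2 the current
-- candidate.  The tables start above the output.

cell : IntExpr → IntExpr → IntExpr → IntExpr
cell K I J = lit 8 +ᶻ (#chosen +ᶻ ((K *ᶻ #points +ᶻ I) *ᶻ #points +ᶻ J))

kᵉ iᵉ jᵉ hᵉ : IntExpr
kᵉ = int[ lit 2 ]
iᵉ = int[ lit 3 ]
jᵉ = int[ lit 4 ]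
hᵉ = int[ lit 5 ]

infeasible : Program
infeasible = real[ lit 2 ]≔ 0ʳ -ʳ 1ʳ

candidate : (contribution : Program) (J H entry : IntExpr) → Program
candidate C J H A =
  C ⨾
  branch (x¹[ J ] <ʳ x¹[ H ])
    (branch (real[ A ] <ʳ 0ʳ) infeasible (real[ lit 2 ]≔ real[ lit 2 ] +ʳ real[ A ]))
    infeasible

smallerDistance : Program
smallerDistance = branch (δ iᵉ jᵉ <ʳ δ jᵉ hᵉ) (real[ lit 2 ]≔ δ iᵉ jᵉ) (real[ lit 2 ]≔ δ jᵉ hᵉ)

trySuccessor : Program
trySuccessor =
  candidate smallerDistance jᵉ hᵉ (cell (kᵉ ∸ᶻ lit 1) jᵉ hᵉ) ⨾
  branch (real[ lit 1 ] <ʳ real[ lit 2 ])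
    (real[ lit 1 ]≔ real[ lit 2 ] ⨾ int[ lit 6 ]≔ hᵉ)
    skip

computeEntry : Program
computeEntry =
  branch (kᵉ =ᶻ lit 0)
    (real[ lit 1 ]≔ δ iᵉ jᵉ)
    (real[ lit 1 ]≔ 0ʳ -ʳ 1ʳ ⨾ for (lit 5) #points trySuccessor)

fillEntry : Program
fillEntry =
  int[ lit 6 ]≔ lit 0 ⨾ computeEntry ⨾
  real[ cell kᵉ iᵉ jᵉ ]≔ real[ lit 1 ] ⨾ int[ cell kᵉ iᵉ jᵉ ]≔ int[ lit 6 ]

fillTable : Program
-- After its first two points a chain lacks at most p - 2 more, so the layers 0, ..., p - 2 are
-- needed.
fillTable = for (lit 2) (#chosen ∸ᶻ lit 1) (for (lit 3) #points (for (lit 4) #points fillEntry))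

tryStart : Program
tryStart =
  candidate (real[ lit 2 ]≔ δ iᵉ jᵉ) iᵉ jᵉ (cell (#chosen ∸ᶻ lit 2) iᵉ jᵉ) ⨾
  branch (real[ lit 0 ] <ʳ real[ lit 2 ])
    (real[ lit 0 ]≔ real[ lit 2 ] ⨾ int[ lit 0 ]≔ iᵉ ⨾ int[ lit 1 ]≔ jᵉ)
    skip

findStart : Program
findStart = real[ lit 0 ]≔ 0ʳ -ʳ 1ʳ ⨾ for (lit 3) #points (for (lit 4) #points tryStart)

appendSuccessor : Program
appendSuccessor =
  int[ int[ #chosen ] +ᶻ lit 2 ]≔
    int[ cell (#chosen ∸ᶻ lit 2 ∸ᶻ int[ #chosen ]) int[ int[ #chosen ] ] int[ int[ #chosen ] +ᶻ lit 1 ] ]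

-- The output overwrites the former loop counters in the low cells, so the counter moves to cell p,
-- just above the output; the tables lie higher still.
reconstruct : Program
reconstruct = for #chosen (#chosen ∸ᶻ lit 2) appendSuccessor

dynamicProgram : Program
dynamicProgram = fillTable ⨾ findStart ⨾ reconstruct

module DynamicProgram
  (ℝ : Reals) (α : Reals.Carrier ℝ) (0<α : Reals._<_ ℝ (Reals.0# ℝ) α)
  (n′ q : ℕ) (x : Vector (Dispersion.Point ℝ α) (suc n′))
  (pareto : Dispersion.ParetoFront ℝ α x) (p≤n : 2 ℕ.+ q ℕ.≤ suc n′)
  (M W : ℕ) (enough : 8 ℕ.+ (2 ℕ.+ q ℕ.+ (2 ℕ.+ q) ℕ.* suc n′ ℕ.* suc n′) ℕ.≤ M)
  (n≤W : suc n′ ℕ.≤ W) where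

  n p : ℕ
  n = suc n′
  p = 2 ℕ.+ q

  open Reals ℝ using (Carrier; 0#; _<_; _≤_; _+_; _⊓_; _<?_)
  open OrderedField ℝ
  open Maximum ℝ
  open Chains ℝ α 0<α x pareto
  open Logic ℝ α p x M W
  open Solution ℝ α 0<α q x pareto M W

  -- The leading `8 +` exposes eight successors, so comparison with a work cell computes to false:
  -- writes to work cells preserve table entries definitionally, and invariants pass through them
  -- without proof.
  addr : ℕ → Fin n → Fin n → ℕ
  addr k i j = 8 ℕ.+ (p ℕ.+ ((k ℕ.* n ℕ.+ toℕ i) ℕ.* n ℕ.+ toℕ j))

  addr<M : ∀ {k} i j → k ℕ.< p → addr k i j ℕ.< M
  addr<M i j k<p = ℕ.<-≤-trans
    (ℕ.+-monoʳ-< 8 (ℕ.+-monoʳ-< p (m*b+r<a*b (m*b+r<a*b k<p (Fin.toℕ<n i)) (Fin.toℕ<n j))))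
    enough

  lit<M : ∀ k {k<8 : True (k ℕ.<? 8)} → k ℕ.< M
  lit<M k {k<8} = ℕ.≤-trans (toWitness k<8) (ℕ.≤-trans (ℕ.m≤m+n 8 _) enough)

  out<M : ∀ {k} → k ℕ.≤ p → k ℕ.< M
  out<M {k} k≤p = ℕ.≤-trans (s≤s k≤p) (ℕ.≤-trans
    (ℕ.+-mono-≤ {1} {8} (s≤s z≤n) (ℕ.m≤m+n p _)) enough)

  addr-injective : ∀ {k k′ i i′ j j′} → addr k i j ≡ addr k′ i′ j′ → k ≡ k′ × i ≡ i′ × j ≡ j′
  addr-injective {k} {k′} {i} {i′} {j} {j′} eq =
    let row≡ , j≡j′ = *+-injective {b = n} (Fin.toℕ<n j) (Fin.toℕ<n j′) (ℕ.+-cancelˡ-≡ (8 ℕ.+ p) _ _ eq)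
        k≡k′ , i≡i′ = *+-injective {b = n} {m = k} {m′ = k′} (Fin.toℕ<n i) (Fin.toℕ<n i′) row≡
    in k≡k′ , Fin.toℕ-injective i≡i′ , Fin.toℕ-injective j≡j′

  cell⇓ : ∀ {σ K I J k} {i j : Fin n} → σ ⊢ K ⇓ᶻ k → σ ⊢ I ⇓ᶻ toℕ i → σ ⊢ J ⇓ᶻ toℕ j →
          σ ⊢ cell K I J ⇓ᶻ addr k i j
  cell⇓ K I J = lit 8 +ᶻ (#chosen +ᶻ ((K *ᶻ #points +ᶻ I) *ᶻ #points +ᶻ J))

  index≤W : ∀ (i : Fin n) → toℕ i ℕ.≤ W
  index≤W i = ℕ.≤-trans (ℕ.<⇒≤ (Fin.toℕ<n i)) n≤W

  Argument : ℕ → Fin n → Fin n → ℕ → Set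
  Argument zero    i j a = ⊤
  Argument (suc k) i j a = Witness k i j a

  Entry : ℕ → Fin n → Fin n → Store → Set
  Entry k i j σ = reals σ (addr k i j) ≡ V k i j × Argument k i j (ints σ (addr k i j))

  -- Finished layers, finished rows of the current layer and the started row together describe a
  -- table filled in lexicographic order.
  Layers : ℕ → Store → Set
  Layers k σ = ∀ l i j → l ℕ.< k → Entry l i j σ

  Rows : ℕ → ℕ → Store → Set
  Rows k t σ = ∀ i j → toℕ i ℕ.< t → Entry k i j σ

  Row : ℕ → Fin n → ℕ → Store → Set
  Row k i t σ = ∀ j → toℕ j ℕ.< t → Entry k i j σ

  -- `candidate` computes `feasible` into real cell 2. The index expressions are evaluated after `C`
  -- has changed that cell, hence their independence of the reals.
  runs-candidate : ∀ {T C σ J H A a Q} {j h : Fin n} {c} →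
    Runs T C (λ σ′ → σ′ ≡ setReal 2 c σ) σ →
    (∀ ρ → ⟨ ints σ , ρ ⟩ ⊢ J ⇓ᶻ toℕ j) → (∀ ρ → ⟨ ints σ , ρ ⟩ ⊢ H ⇓ᶻ toℕ h) →
    (∀ ρ → ⟨ ints σ , ρ ⟩ ⊢ A ⇓ᶻ 8 ℕ.+ a) → 8 ℕ.+ a ℕ.< M →
    (∀ r → r ≡ feasible j h c (reals σ (8 ℕ.+ a)) → Q (setReal 2 r (setReal 2 c σ))) →
    Runs T (candidate C J H A) Q σ
  runs-candidate {T} {C} {σ} {J} {H} {A} {a} {Q} {j} {h} {c} runsC J⇓ H⇓ A⇓ a<M q =
    runs-seq (runs-post (λ { _ refl → rest }) runsC)
    where
    σ₁ = setReal 2 c σ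
    v = reals σ (8 ℕ.+ a)
    rest : Runs T (branch (x¹[ J ] <ʳ x¹[ H ])
             (branch (real[ A ] <ʳ 0ʳ) infeasible (real[ lit 2 ]≔ real[ lit 2 ] +ʳ real[ A ]))
             infeasible) Q σ₁
    rest = runs-branch (proj₁ (x j) <? proj₁ (x h)) (x¹[ J⇓ _ ] <ʳ x¹[ H⇓ _ ])
      (λ j◁h → runs-branch (v <? 0#) (real (A⇓ _) a<M <ʳ 0ʳ)
        (λ v<0 → fail (sym (feasible-neg v<0)))
        (λ v≮0 → runs-real (lit 2) (lit<M 2)
          (readʳ (lit<M 2) +ʳ real (A⇓ _) a<M)
          (q _ (sym (feasible-≡ j◁h (≮⇒≥ v≮0))))))
      (λ j⋪h → fail (sym (feasible-≮ j⋪h)))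
      where
      fail : -1# ≡ feasible j h c v → Runs T infeasible Q σ₁
      fail eq = runs-real (lit 2) (lit<M 2) (0ʳ -ʳ 1ʳ) (q -1# eq)

  via : ℕ → Fin n → Fin n → Fin n → Carrier
  via k i j h = feasible j h (f i j ⊓ f j h) (V k j h)

  AtEntry : ℕ → Fin n → Fin n → Store → Set
  AtEntry k i j σ = ints σ 2 ≡ k × ints σ 3 ≡ toℕ i × ints σ 4 ≡ toℕ j ×
                    Layers k σ × Rows k (toℕ i) σ × Row k i (toℕ j) σ

  Searched : ℕ → Fin n → Fin n → ℕ → Store → Set
  Searched k i j t σ =
    ints σ 6 ℕ.≤ W × -1# ≤ reals σ 1 × (∀ h → toℕ h ℕ.< t → via k i j h ≤ reals σ 1) ×
    (reals σ 1 ≡ -1# ⊎ ∃[ h ] ints σ 6 ≡ toℕ h × reals σ 1 ≡ via k i j h)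

  runs-smallerDistance : ∀ {T σ} {i j h : Fin n} →
    ints σ 3 ≡ toℕ i → ints σ 4 ≡ toℕ j → ints σ 5 ≡ toℕ h →
    Runs T smallerDistance (λ σ′ → σ′ ≡ setReal 2 (f i j ⊓ f j h) σ) σ
  runs-smallerDistance {T} {σ} {i} {j} {h} i≡ j≡ h≡ = runs-branch (f i j <? f j h) (ij <ʳ jh)
    (λ lt → runs-real (lit 2) (lit<M 2) ij (cong (λ v → setReal 2 v σ) (sym (⊓-< lt))))
    (λ ge → runs-real (lit 2) (lit<M 2) jh (cong (λ v → setReal 2 v σ) (sym (⊓-≮ ge))))
    where
    ij : σ ⊢ δ iᵉ jᵉ ⇓ʳ f i j
    ij = δ⇓ (read (lit<M 3) i≡) (read (lit<M 4) j≡)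
    jh : σ ⊢ δ jᵉ hᵉ ⇓ʳ f j h
    jh = δ⇓ (read (lit<M 4) j≡) (read (lit<M 5) h≡)

  runs-trySuccessor : ∀ {T k i j σ} → k ℕ.< p → ∀ h → ints σ 5 ≡ toℕ h →
    AtEntry (suc k) i j σ × Searched k i j (toℕ h) σ →
    Runs T trySuccessor
      (λ σ′ → ints σ′ 5 ≡ toℕ h ×
              AtEntry (suc k) i j σ′ × Searched k i j (suc (toℕ h)) σ′) σ
  runs-trySuccessor {T} {k} {i} {j} {σ} k<p h h≡
    (at@(k≡ , i≡ , j≡ , layers , _) , (arg≤W , -1≤ , above , attained)) =
    runs-seq (runs-candidate (runs-smallerDistance i≡ j≡ h≡)
      (λ _ → read (lit<M 4) j≡) (λ _ → read (lit<M 5) h≡)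
      (λ _ → cell⇓ (read (lit<M 2) k≡ ∸ᶻ lit 1) (read (lit<M 4) j≡) (read (lit<M 5) h≡))
      (addr<M j h k<p)
      λ r r≡ → improve r (trans r≡ (cong (feasible j h _) (proj₁ (layers k j h ℕ.≤-refl)))))
    where
    c = f i j ⊓ f j h
    improve : ∀ r → r ≡ via k i j h →
      Runs T (branch (real[ lit 1 ] <ʳ real[ lit 2 ])
               (real[ lit 1 ]≔ real[ lit 2 ] ⨾ int[ lit 6 ]≔ hᵉ) skip)
        (λ σ′ → ints σ′ 5 ≡ toℕ h × AtEntry (suc k) i j σ′ × Searched k i j (suc (toℕ h)) σ′)
        (setReal 2 r (setReal 2 c σ))
    improve r r≡ = runs-branch (reals σ 1 <? r) (readʳ (lit<M 1) <ʳ readʳ (lit<M 2))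
      (λ best<r → runs-seq (runs-real (lit 1) (lit<M 1) (readʳ (lit<M 2))
        (runs-int (lit 6) (lit<M 6) (read (lit<M 5) h≡) (index≤W h)
          (h≡ , at , index≤W h , ≤-trans -1≤ (inj₁ best<r) ,
           (λ h′ h′< → [ (λ lt → ≤-trans (above h′ lt) (inj₁ best<r)) , (λ { refl → inj₂ (sym r≡) }) ]′
                         (toℕ-<suc h′<)) ,
           inj₂ (h , refl , r≡)))))
      (λ best≮r → runs-skip
        (h≡ , at , arg≤W , -1≤ ,
         (λ h′ h′< → [ above h′ , (λ { refl → subst (_≤ reals σ 1) r≡ (≮⇒≥ best≮r) }) ]′ (toℕ-<suc h′<)) ,
         attained))

  -- Their successors are n, n², n³ and pn³, the iteration counts of the loops nested over h, j, i
  -- and k.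
  T₁ T₂ T₃ T₄ : ℕ
  T₁ = n′
  T₂ = ℕ.pred (n ℕ.* suc T₁)
  T₃ = ℕ.pred (n ℕ.* suc T₂)
  T₄ = ℕ.pred (p ℕ.* suc T₃)

  runs-computeEntry : ∀ {k i j σ} → k ℕ.≤ q → AtEntry k i j σ → ints σ 6 ℕ.≤ W →
    Runs T₁ computeEntry
      (λ σ′ → AtEntry k i j σ′ × ints σ′ 6 ℕ.≤ W ×
              reals σ′ 1 ≡ V k i j × Argument k i j (ints σ′ 6)) σ
  runs-computeEntry {zero} k≤q at@(k≡ , i≡ , j≡ , _) arg≤W =
    runs-branch (0 ℕ.≟ 0) (read (lit<M 2) k≡ =ᶻ lit 0)
      (λ _ → runs-real (lit 1) (lit<M 1) (δ⇓ (read (lit<M 3) i≡) (read (lit<M 4) j≡))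
        (at , arg≤W , refl , tt))
      (λ 0≢0 → contradiction refl 0≢0)
  runs-computeEntry {suc k} {i} {j} k<q at@(k≡ , i≡ , j≡ , _) arg≤W =
    runs-branch (suc k ℕ.≟ 0) (read (lit<M 2) k≡ =ᶻ lit 0)
      (λ ())
      (λ _ → runs-seq (runs-real (lit 1) (lit<M 1) (0ʳ -ʳ 1ʳ)
        (runs-forPoints {T = 0} (λ t σ → AtEntry (suc k) i j σ × Searched k i j t σ)
          (λ _ → lit 5) (lit<M 5) n≤W (ℕ.≤-reflexive (ℕ.*-identityʳ n))
          (λ h σ h≡ inv → runs-trySuccessor (ℕ.m≤n⇒m≤1+n (ℕ.m≤n⇒m≤1+n k<q)) h h≡ inv)
          (at , arg≤W , ≤-refl , (λ _ ()) , inj₁ refl)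
          finish)))
    where
    finish : ∀ σ → AtEntry (suc k) i j σ × Searched k i j n σ →
             AtEntry (suc k) i j σ × ints σ 6 ℕ.≤ W ×
             reals σ 1 ≡ V (suc k) i j × Witness k i j (ints σ 6)
    finish σ (at , arg≤W , -1≤ , above , attained) = at , arg≤W , value , witness attained
      where
      value : reals σ 1 ≡ V (suc k) i j
      value = maximum-unique (via k i j) -1≤ (λ h → above h (Fin.toℕ<n h))
        ([ inj₁ , (λ { (h , _ , eq) → inj₂ (h , eq) }) ]′ attained)
      witness : (reals σ 1 ≡ -1# ⊎ ∃[ h ] ints σ 6 ≡ toℕ h × reals σ 1 ≡ via k i j h) →
                Witness k i j (ints σ 6)
      witness (inj₁ eq) 0≤V = contradiction -1<0
        (≤⇒≯ (subst (0# ≤_) (trans (sym value) eq) 0≤V))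
      witness (inj₂ (h , h≡ , eq)) _ = h , h≡ , trans (sym value) eq

  entry-preserved : ∀ {k i j k′ i′ j′ σ a v} → Entry k′ i′ j′ σ → ¬ (k′ ≡ k × i′ ≡ i × j′ ≡ j) →
    Entry k′ i′ j′ (setInt (addr k i j) a (setReal (addr k i j) v σ))
  entry-preserved {k} {i} {j} {k′} {i′} {j′} {σ} {a} {v} (value , arg) differs =
    trans (update-other (reals σ) v addr≢) value ,
    subst (Argument k′ i′ j′) (sym (update-other (ints σ) a addr≢)) arg
    where
    addr≢ : addr k′ i′ j′ ≢ addr k i j
    addr≢ = differs ∘ addr-injective {k′} {k}

  entry-written : ∀ {k i j σ a v} → v ≡ V k i j → Argument k i j a →
    Entry k i j (setInt (addr k i j) a (setReal (addr k i j) v σ))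
  entry-written {k} {i} {j} {σ} {a} {v} value arg =
    trans (update-same (reals σ) (addr k i j) v) value ,
    subst (Argument k i j) (sym (update-same (ints σ) (addr k i j) a)) arg

  AtRow : ℕ → Fin n → ℕ → Store → Set
  AtRow k i t σ = ints σ 2 ≡ k × ints σ 3 ≡ toℕ i × Layers k σ × Rows k (toℕ i) σ × Row k i t σ

  runs-fillEntry : ∀ {k i σ} → k ℕ.≤ q → ∀ j → ints σ 4 ≡ toℕ j → AtRow k i (toℕ j) σ →
    Runs T₁ fillEntry (λ σ′ → ints σ′ 4 ≡ toℕ j × AtRow k i (suc (toℕ j)) σ′) σ
  runs-fillEntry {k} {i} {σ} k≤q j j≡ (k≡ , i≡ , layers , rows , row) =
    runs-seq (runs-int (lit 6) (lit<M 6) (lit 0) z≤n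
      (runs-seq (runs-post write
        (runs-computeEntry k≤q (k≡ , i≡ , j≡ , layers , rows , row) z≤n))))
    where
    k<p : k ℕ.< p
    k<p = s≤s (ℕ.m≤n⇒m≤1+n k≤q)
    write : ∀ σ → AtEntry k i j σ × ints σ 6 ℕ.≤ W × reals σ 1 ≡ V k i j × Argument k i j (ints σ 6) →
      Runs T₁ (real[ cell kᵉ iᵉ jᵉ ]≔ real[ lit 1 ] ⨾ int[ cell kᵉ iᵉ jᵉ ]≔ int[ lit 6 ])
        (λ σ′ → ints σ′ 4 ≡ toℕ j × AtRow k i (suc (toℕ j)) σ′) σ
    write σ ((k≡ , i≡ , j≡ , layers , rows , row) , arg≤W , value , arg) =
      runs-seq (runs-real (cell⇓ (read (lit<M 2) k≡) (read (lit<M 3) i≡) (read (lit<M 4) j≡))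
        (addr<M i j k<p) (readʳ (lit<M 1))
        (runs-int (cell⇓ (read (lit<M 2) k≡) (read (lit<M 3) i≡) (read (lit<M 4) j≡))
          (addr<M i j k<p) (read (lit<M 6) refl) arg≤W
          (j≡ , k≡ , i≡ ,
           (λ l i′ j′ l<k → entry-preserved {k} {i} {j} {l} {σ = σ} (layers l i′ j′ l<k)
              λ { (l≡k , _) → ℕ.<-irrefl l≡k l<k }) ,
           (λ i′ j′ i′<i → entry-preserved {k} {i} {j} {k} {σ = σ} (rows i′ j′ i′<i)
              λ { (_ , i′≡i , _) → ℕ.<-irrefl (cong toℕ i′≡i) i′<i }) ,
           (λ j′ j′< → [ (λ j′<j → entry-preserved {k} {i} {j} {k} {σ = σ} (row j′ j′<j)
                            λ { (_ , _ , j′≡j) → ℕ.<-irrefl (cong toℕ j′≡j) j′<j })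
                       , (λ { refl → entry-written {k} {σ = σ} value arg }) ]′ (toℕ-<suc j′<)))))

  runs-fillTable : ∀ {σ} → Runs T₄ fillTable (Layers (suc q)) σ
  runs-fillTable = runs-for {T = T₃} Layers (λ _ → lit 2) (lit<M 2) (λ _ → #chosen ∸ᶻ lit 1)
    (ℕ.≤-trans (ℕ.n≤1+n (suc q)) (ℕ.≤-trans p≤n n≤W))
    (ℕ.*-monoˡ-≤ (suc T₃) (ℕ.n≤1+n (suc q)))
    layer (λ _ _ _ ()) (λ _ layers → layers)
    where
    layer : ∀ k σ → k ℕ.< suc q → ints σ 2 ≡ k → Layers k σ →
            Runs T₃ (for (lit 3) #points (for (lit 4) #points fillEntry))
              (λ σ′ → ints σ′ 2 ≡ k × Layers (suc k) (setInt 2 (suc k) σ′)) σ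
    layer k σ k<1+q k≡ layers =
      runs-forPoints {T = T₂} (λ t σ → ints σ 2 ≡ k × Layers k σ × Rows k t σ)
        (λ _ → lit 3) (lit<M 3) n≤W ℕ.≤-refl rowLoop
        (k≡ , layers , λ _ _ ())
        (λ { σ′ (k≡ , layers , rows) → k≡ ,
             λ l i j l<1+k → [ layers l i j , (λ { refl → rows i j (Fin.toℕ<n i) }) ]′
                               (ℕ.m≤n⇒m<n∨m≡n (ℕ.≤-pred l<1+k)) })
      where
      rowLoop : ∀ i σ → ints σ 3 ≡ toℕ i → ints σ 2 ≡ k × Layers k σ × Rows k (toℕ i) σ →
                Runs T₂ (for (lit 4) #points fillEntry)
                  (λ σ′ → ints σ′ 3 ≡ toℕ i × ints σ′ 2 ≡ k × Layers k σ′ × Rows k (suc (toℕ i)) σ′) σ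
      rowLoop i σ i≡ (k≡ , layers , rows) =
        runs-forPoints {T = T₁} (AtRow k i) (λ _ → lit 4) (lit<M 4) n≤W ℕ.≤-refl
          (λ j σ → runs-fillEntry (ℕ.≤-pred k<1+q) j)
          (k≡ , i≡ , layers , rows , λ _ ())
          (λ { σ′ (k≡ , i≡ , layers , rows , row) → i≡ , k≡ , layers ,
               λ i′ j i′< → [ rows i′ j , (λ { refl → row j (Fin.toℕ<n j) }) ]′ (toℕ-<suc i′<) })

  start : Fin n → Fin n → Carrier
  start i j = feasible i j (f i j) (V q i j)

  chainVal≤start : ∀ {s} → Chain q s → chainVal q s ≤ start (s 0) (s 1)
  chainVal≤start {s} c = ≤-trans (+-mono-≤ ≤-refl (tailVal≤V q c))
    (inj₂ (sym (feasible-≡ (c 0 z≤n) (≤-trans (0≤tailVal q s) (tailVal≤V q c)))))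

  Found : Store → Set
  Found σ = Layers (suc q) σ ×
    (reals σ 0 ≡ -1# ⊎ ∃[ i ] ∃[ j ] ints σ 0 ≡ toℕ i × ints σ 1 ≡ toℕ j × reals σ 0 ≡ start i j)

  ScannedRows : ℕ → Store → Set
  ScannedRows t σ = ∀ i j → toℕ i ℕ.< t → start i j ≤ reals σ 0

  AtStart : Fin n → ℕ → Store → Set
  AtStart i t σ = ints σ 3 ≡ toℕ i × Found σ × ScannedRows (toℕ i) σ ×
                  (∀ j → toℕ j ℕ.< t → start i j ≤ reals σ 0)

  runs-tryStart : ∀ {T i σ} → ∀ j → ints σ 4 ≡ toℕ j → AtStart i (toℕ j) σ →
    Runs T tryStart (λ σ′ → ints σ′ 4 ≡ toℕ j × AtStart i (suc (toℕ j)) σ′) σ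
  runs-tryStart {T} {i} {σ} j j≡ (i≡ , (layers , found) , rows , row) =
    runs-seq (runs-candidate
      (runs-real (lit 2) (lit<M 2) (δ⇓ (read (lit<M 3) i≡) (read (lit<M 4) j≡)) refl)
      (λ _ → read (lit<M 3) i≡) (λ _ → read (lit<M 4) j≡)
      (λ _ → cell⇓ (#chosen ∸ᶻ lit 2) (read (lit<M 3) i≡) (read (lit<M 4) j≡))
      (addr<M i j (s≤s (ℕ.n≤1+n q)))
      λ r r≡ → improve r (trans r≡ (cong (feasible i j (f i j)) (proj₁ (layers q i j ℕ.≤-refl)))))
    where
    improve : ∀ r → r ≡ start i j →
      Runs T (branch (real[ lit 0 ] <ʳ real[ lit 2 ])
               (real[ lit 0 ]≔ real[ lit 2 ] ⨾ int[ lit 0 ]≔ iᵉ ⨾ int[ lit 1 ]≔ jᵉ) skip)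
        (λ σ′ → ints σ′ 4 ≡ toℕ j × AtStart i (suc (toℕ j)) σ′)
        (setReal 2 r (setReal 2 (f i j) σ))
    improve r r≡ = runs-branch (reals σ 0 <? r) (readʳ (lit<M 0) <ʳ readʳ (lit<M 2))
      (λ best<r → runs-seq (runs-real (lit 0) (lit<M 0) (readʳ (lit<M 2))
        (runs-seq (runs-int (lit 0) (lit<M 0) (read (lit<M 3) i≡) (index≤W i)
          (runs-int (lit 1) (lit<M 1) (read (lit<M 4) j≡) (index≤W j)
            (j≡ , i≡ , (layers , inj₂ (i , j , refl , refl , r≡)) ,
             (λ i′ j′ lt → ≤-trans (rows i′ j′ lt) (inj₁ best<r)) ,
             λ j′ j′< → [ (λ lt → ≤-trans (row j′ lt) (inj₁ best<r)) , (λ { refl → inj₂ (sym r≡) }) ]′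
                          (toℕ-<suc j′<)))))))
      (λ best≮r → runs-skip
        (j≡ , i≡ , (layers , found) , rows ,
         λ j′ j′< → [ row j′ , (λ { refl → subst (_≤ reals σ 0) r≡ (≮⇒≥ best≮r) }) ]′ (toℕ-<suc j′<)))

  runs-findStart : ∀ {σ} → Layers (suc q) σ →
                   Runs T₄ findStart (λ σ′ → Found σ′ × ScannedRows n σ′) σ
  runs-findStart layers = runs-seq (runs-real (lit 0) (lit<M 0) (0ʳ -ʳ 1ʳ)
    (runs-forPoints {T = T₁} (λ t σ → Found σ × ScannedRows t σ) (λ _ → lit 3) (lit<M 3) n≤W
      -- The n² pairs are charged to the budget pn³ of the whole program.
      (ℕ.≤-trans (ℕ.m≤n*m (suc T₂) n) (ℕ.m≤n*m (suc T₃) p))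
      (λ i σ i≡ (found , rows) →
        runs-forPoints {T = 0} (AtStart i) (λ _ → lit 4) (lit<M 4) n≤W
          (ℕ.≤-reflexive (ℕ.*-identityʳ n))
          (λ j σ → runs-tryStart j)
          (i≡ , found , rows , λ _ ())
          (λ { σ′ (i≡ , found , rows , row) → i≡ , found ,
               λ i′ j i′< → [ rows i′ j , (λ { refl → row j (Fin.toℕ<n j) }) ]′ (toℕ-<suc i′<) }))
      ((layers , inj₁ refl) , λ _ _ ())
      (λ _ inv → inv)))

  -- Of the integers, only the table and the output written so far have to survive; the work cells
  -- may be overwritten.
  Written : Store → Sel → ℕ → Store → Set
  Written σ₀ s t σ = (∀ a → ints σ (8 ℕ.+ (p ℕ.+ a)) ≡ ints σ₀ (8 ℕ.+ (p ℕ.+ a))) ×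
    (∀ m → m ℕ.< 2 ℕ.+ t → ints σ m ≡ toℕ (s m)) × reals σ ≡ reals σ₀

  table≢output : ∀ a {m} → m ℕ.≤ p → 8 ℕ.+ (p ℕ.+ a) ≢ m
  table≢output a {m} m≤p refl = ℕ.<-irrefl refl
    (ℕ.<-≤-trans (ℕ.m<n+m p {8} (s≤s z≤n)) (ℕ.≤-trans (ℕ.+-monoʳ-≤ 8 (ℕ.m≤m+n p a)) m≤p))

  module _ (σ₀ : Store) (s : Sel)
    (successor : ∀ m → m ℕ.< q → ints σ₀ (addr (q ℕ.∸ m) (s m) (s (suc m))) ≡ toℕ (s (2 ℕ.+ m)))
    where

    written-counter : ∀ {t v σ} → t ℕ.≤ q → Written σ₀ s t σ → Written σ₀ s t (setInt p v σ)
    written-counter {t} {v} {σ} t≤q (table , outputs , values) =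
      (λ a → trans (update-other (ints σ) v (table≢output a ℕ.≤-refl)) (table a)) ,
      (λ m m<2+t → trans (update-other (ints σ) v
        (λ { refl → ℕ.<-irrefl refl (ℕ.<-≤-trans m<2+t (s≤s (s≤s t≤q))) })) (outputs m m<2+t)) ,
      values

    runs-appendSuccessor : ∀ {T} m σ → m ℕ.< q → ints σ p ≡ m → Written σ₀ s m σ →
      Runs T appendSuccessor
        (λ σ′ → ints σ′ p ≡ m × Written σ₀ s (suc m) (setInt p (suc m) σ′)) σ
    runs-appendSuccessor m σ m<q m≡ (table , outputs , values) =
      runs-int (counter +ᶻ lit 2) (out<M (ℕ.<⇒≤ m+2<p))
        (int (cell⇓ (#chosen ∸ᶻ lit 2 ∸ᶻ counter) first second) (addr<M (s m) (s (suc m)) q∸m<p))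
        (subst (ℕ._≤ W) (sym next) (index≤W (s (2 ℕ.+ m))))
        (trans (update-other (ints σ) _ (ℕ.>⇒≢ m+2<p)) m≡ ,
         written-counter m<q
           ((λ a → trans (update-other (ints σ) _ (table≢output a (ℕ.<⇒≤ m+2<p))) (table a)) ,
            outputs′ , values))
      where
      m+2<p : m ℕ.+ 2 ℕ.< p
      m+2<p = subst (ℕ._< p) (ℕ.+-comm 2 m) (s≤s (s≤s m<q))
      q∸m<p : q ℕ.∸ m ℕ.< p
      q∸m<p = s≤s (ℕ.m≤n⇒m≤1+n (ℕ.m∸n≤m q m))
      counter : σ ⊢ int[ #chosen ] ⇓ᶻ m
      counter = subst (σ ⊢ int[ #chosen ] ⇓ᶻ_) m≡ (int #chosen (out<M ℕ.≤-refl))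
      m+1≡ : ints σ (m ℕ.+ 1) ≡ toℕ (s (suc m))
      m+1≡ = trans (cong (ints σ) (ℕ.+-comm m 1)) (outputs (suc m) ℕ.≤-refl)
      first : σ ⊢ int[ int[ #chosen ] ] ⇓ᶻ toℕ (s m)
      first = subst (σ ⊢ int[ int[ #chosen ] ] ⇓ᶻ_) (outputs m (ℕ.n≤1+n (suc m)))
        (int counter (out<M (ℕ.<⇒≤ (ℕ.m+n≤o⇒m≤o (suc m) m+2<p))))
      second : σ ⊢ int[ int[ #chosen ] +ᶻ lit 1 ] ⇓ᶻ toℕ (s (suc m))
      second = subst (σ ⊢ int[ int[ #chosen ] +ᶻ lit 1 ] ⇓ᶻ_) m+1≡
        (int (counter +ᶻ lit 1) (out<M (ℕ.≤-trans (ℕ.+-monoʳ-≤ m (s≤s z≤n)) (ℕ.<⇒≤ m+2<p))))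
      new = addr (q ℕ.∸ m) (s m) (s (suc m))
      next : ints σ new ≡ toℕ (s (2 ℕ.+ m))
      next = trans (table _) (successor m m<q)
      outputs′ : ∀ l → l ℕ.< 3 ℕ.+ m → update (ints σ) (m ℕ.+ 2) (ints σ new) l ≡ toℕ (s l)
      outputs′ l l<3+m with ℕ.m≤n⇒m<n∨m≡n (ℕ.≤-pred l<3+m)
      ... | inj₁ l<2+m = trans (update-other (ints σ) _
        (λ l≡ → ℕ.<-irrefl (trans l≡ (ℕ.+-comm m 2)) l<2+m)) (outputs l l<2+m)
      ... | inj₂ refl  = trans
        (cong (update (ints σ) (m ℕ.+ 2) (ints σ new)) (ℕ.+-comm 2 m))
        (trans (update-same (ints σ) (m ℕ.+ 2) _) next)

    runs-reconstruct : Chain q s → ints σ₀ 0 ≡ toℕ (s 0) → ints σ₀ 1 ≡ toℕ (s 1) →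
      reals σ₀ 0 ≡ chainVal q s → (∀ s′ → Chain q s′ → chainVal q s′ ≤ chainVal q s) →
      Runs T₄ reconstruct Solved σ₀
    runs-reconstruct c s₀≡ s₁≡ value best =
      runs-for {T = 0} (Written σ₀ s) (λ _ → #chosen) (out<M ℕ.≤-refl) (λ _ → #chosen ∸ᶻ lit 2)
        (ℕ.≤-trans (ℕ.m≤n+m q 2) (ℕ.≤-trans p≤n n≤W))
        (ℕ.≤-trans (ℕ.≤-reflexive (ℕ.*-identityʳ q))
          (ℕ.≤-trans (ℕ.m≤n+m q 2) (ℕ.m≤m*n p (suc T₃))))
        runs-appendSuccessor
        (written-counter z≤n ((λ _ → refl) , initialOutputs , refl))
        (λ { σ (_ , outputs , values) →
             s , c , outputs , trans (cong (λ ρ → ρ 0) values) value , best })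
      where
      initialOutputs : ∀ m → m ℕ.< 2 → ints σ₀ m ≡ toℕ (s m)
      initialOutputs zero          _ = s₀≡
      initialOutputs (suc zero)    _ = s₁≡
      initialOutputs (suc (suc _)) (s≤s (s≤s ()))

  runs-dynamicProgram : Runs T₄ dynamicProgram Solved initial
  runs-dynamicProgram =
    runs-seq (runs-post (λ _ layers → runs-seq (runs-post finish (runs-findStart layers))) runs-fillTable)
    where
    finish : ∀ σ → Found σ × ScannedRows n σ → Runs T₄ reconstruct Solved σ
    finish σ ((layers , found) , scanned) = optimum found
      where
      bound : ∀ s → Chain q s → chainVal q s ≤ reals σ 0
      bound s c = ≤-trans (chainVal≤start c) (scanned (s 0) (s 1) (Fin.toℕ<n (s 0)))
      -- Since p ≤ n, some chain exists, so the best value is nonnegative. This excludes the initial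
      -- -1 and makes the recorded pair feasible, which `trace` requires.
      0≤best : 0# ≤ reals σ 0
      0≤best = let s , c = chain-exists q p≤n in ≤-trans (0≤chainVal q s) (bound s c)
      argument : ℕ → Fin n → Fin n → ℕ
      argument k i j = ints σ (addr k i j)
      optimum : (reals σ 0 ≡ -1# ⊎ ∃[ i ] ∃[ j ] ints σ 0 ≡ toℕ i × ints σ 1 ≡ toℕ j × reals σ 0 ≡ start i j) →
                Runs T₄ reconstruct Solved σ
      optimum (inj₁ best≡-1) = contradiction -1<0 (≤⇒≯ (subst (0# ≤_) best≡-1 0≤best))
      optimum (inj₂ (i , j , i≡ , j≡ , best≡)) =
        let i◁j , 0≤V , start≡ = feasible-sound (subst (0# ≤_) best≡ 0≤best)
            s , s₀≡ , s₁≡ , c , tail≡ , successor =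
              trace argument q (λ m m<q i j → proj₂ (layers (suc m) i j (s≤s m<q))) i◁j 0≤V
            value : reals σ 0 ≡ chainVal q s
            value = trans best≡ (trans start≡ (cong₂ _+_ (sym (cong₂ f s₀≡ s₁≡)) (sym tail≡)))
        in runs-reconstruct σ s successor c
             (trans i≡ (cong toℕ (sym s₀≡))) (trans j≡ (cong toℕ (sym s₁≡)))
             value (λ s′ c′ → subst (chainVal q s′ ≤_) value (bound s′ c′))

-- Exhaustive search

-- With p = 2 + q, integer cells 0, …, p-1 hold the best chain found so far and
-- cells p, …, 2p-1 the current one, whose ends are the extreme points.  The
-- real cells 0 and 1 hold their values.

addTerm : RealExpr → Program
addTerm r = real[ lit 1 ]≔ real[ lit 1 ] +ʳ r

-- Unrolled over the chain, hence of a size independent of n. The tests are nested so that `P` is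
-- reached only by chains.
evaluate : (finish : Program) (k base : ℕ) → Program
evaluate P zero    b =
  branch (x¹[ int[ lit b ] ] <ʳ x¹[ int[ lit (1 ℕ.+ b) ] ])
    (addTerm (δ int[ lit b ] int[ lit (1 ℕ.+ b) ]) ⨾ P)
    skip
evaluate P (suc k) b =
  branch (x¹[ int[ lit b ] ] <ʳ x¹[ int[ lit (1 ℕ.+ b) ] ])
    (branch (δ int[ lit b ] int[ lit (1 ℕ.+ b) ] <ʳ δ int[ lit (1 ℕ.+ b) ] int[ lit (2 ℕ.+ b) ])
       (addTerm (δ int[ lit b ] int[ lit (1 ℕ.+ b) ]))
       (addTerm (δ int[ lit (1 ℕ.+ b) ] int[ lit (2 ℕ.+ b) ])) ⨾
     evaluate P k (suc b))
    skip

copy : (base count : ℕ) → Program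
copy b zero    = skip
copy b (suc m) = copy b m ⨾ int[ lit m ]≔ int[ lit (m ℕ.+ b) ]

recordBetter : ℕ → Program
recordBetter p =
  branch (real[ lit 0 ] <ʳ real[ lit 1 ]) (real[ lit 0 ]≔ real[ lit 1 ] ⨾ copy p p) skip

tryChain : ℕ → Program
tryChain q = real[ lit 1 ]≔ δ int[ lit p ] int[ lit (1 ℕ.+ p) ] ⨾ evaluate (recordBetter p) q p
  where p = 2 ℕ.+ q

-- The inner entries of the current chain are themselves the loop counters: position q belongs to
-- the outermost loop and position 1 to the innermost.
enumerate : (q inner : ℕ) → Program
enumerate q zero    = tryChain q
enumerate q (suc m) = for (lit (suc m ℕ.+ (2 ℕ.+ q))) #points (enumerate q m)

-- The counter occupies cell 2p, the only cell beyond the current chain. Both ends initially hold 0,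
-- which is a valid point index.
findExtremes : ℕ → Program
findExtremes q = for (lit (p ℕ.+ p)) #points
  (branch (x¹[ int[ lit (p ℕ.+ p) ] ] <ʳ x¹[ int[ lit p ] ])
     (int[ lit p ]≔ int[ lit (p ℕ.+ p) ]) skip ⨾
   branch (x¹[ int[ lit (suc q ℕ.+ p) ] ] <ʳ x¹[ int[ lit (p ℕ.+ p) ] ])
     (int[ lit (suc q ℕ.+ p) ]≔ int[ lit (p ℕ.+ p) ]) skip)
  where p = 2 ℕ.+ q

exhaustiveSearch : ℕ → Program
exhaustiveSearch q = findExtremes q ⨾ real[ lit 0 ]≔ 0ʳ -ʳ 1ʳ ⨾ enumerate q q

module ExhaustiveSearch
  (ℝ : Reals) (α : Reals.Carrier ℝ) (0<α : Reals._<_ ℝ (Reals.0# ℝ) α)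
  (n′ q : ℕ) (x : Vector (Dispersion.Point ℝ α) (suc n′))
  (pareto : Dispersion.ParetoFront ℝ α x) (p≤n : 2 ℕ.+ q ℕ.≤ suc n′)
  (M W : ℕ) (enough : (2 ℕ.+ q) ℕ.+ (2 ℕ.+ q) ℕ.< M) (n≤W : suc n′ ℕ.≤ W) where

  n p : ℕ
  n = suc n′
  p = 2 ℕ.+ q

  open Reals ℝ using (Carrier; 0#; _<_; _≤_; _+_; _⊓_; _<?_)
  open OrderedField ℝ
  open Maximum ℝ
  open Chains ℝ α 0<α x pareto
  open Logic ℝ α p x M W
  open Solution ℝ α 0<α q x pareto M W

  current<M : ∀ {m} → m ℕ.≤ p → m ℕ.+ p ℕ.< M
  current<M m≤p = ℕ.≤-<-trans (ℕ.+-monoˡ-≤ p m≤p) enough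

  output<M : ∀ {m} → m ℕ.≤ p → m ℕ.< M
  output<M {m} m≤p = ℕ.≤-<-trans (ℕ.m≤m+n m p) (current<M m≤p)

  0<M : 0 ℕ.< M
  0<M = output<M z≤n

  1<M : 1 ℕ.< M
  1<M = output<M (s≤s z≤n)

  index≤W : ∀ (i : Fin n) → toℕ i ℕ.≤ W
  index≤W i = ℕ.≤-trans (ℕ.<⇒≤ (Fin.toℕ<n i)) n≤W

  output≢current : ∀ {l m} → l ℕ.< p → l ≢ m ℕ.+ p
  output≢current {m = m} l<p refl = ℕ.<-irrefl refl (ℕ.<-≤-trans l<p (ℕ.m≤n+m p m))

  current-injective : ∀ {l m} → l ≢ m → l ℕ.+ p ≢ m ℕ.+ p
  current-injective {l} {m} l≢m = l≢m ∘ ℕ.+-cancelʳ-≡ p l m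

  Holds : ℕ → ℕ → Sel → Store → Set
  Holds k b s σ = ∀ m → m ℕ.≤ suc k → ints σ (m ℕ.+ b) ≡ toℕ (s m)

  -- Real cell 1 accumulates the value. A failed test leaves a partial sum there, so in that case
  -- only real cell 0 is known to be preserved.
  runs-evaluate : ∀ {T P Q} k b s σ → suc k ℕ.+ b ℕ.< M → Holds k b s σ →
    (Chain k s → ∀ ρ → ρ 0 ≡ reals σ 0 → ρ 1 ≡ reals σ 1 + tailVal k s → Runs T P Q ⟨ ints σ , ρ ⟩) →
    (¬ Chain k s → ∀ ρ → ρ 0 ≡ reals σ 0 → Q ⟨ ints σ , ρ ⟩) →
    Runs T (evaluate P k b) Q σ
  runs-evaluate zero b s σ b+1<M holds onChain otherwise =
    runs-branch (proj₁ (x (s 0)) <? proj₁ (x (s 1))) (x¹[ first ] <ʳ x¹[ second ])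
      (λ s₀◁s₁ → runs-seq (runs-real (lit 1) 1<M (readʳ 1<M +ʳ δ⇓ first second)
        (onChain (λ { zero _ → s₀◁s₁ }) _ refl refl)))
      (λ s₀⋪s₁ → runs-skip (otherwise (λ c → s₀⋪s₁ (c 0 z≤n)) _ refl))
    where
    first = read {σ} (ℕ.<⇒≤ b+1<M) (holds 0 z≤n)
    second = read {σ} b+1<M (holds 1 (s≤s z≤n))
  runs-evaluate {T} {P} {Q} (suc k) b s σ k+b<M holds onChain otherwise =
    runs-branch (proj₁ (x (s 0)) <? proj₁ (x (s 1))) (x¹[ first ] <ʳ x¹[ second ])
      (λ s₀◁s₁ → runs-seq (runs-post (λ { _ refl → later s₀◁s₁ }) addMinimum))
      (λ s₀⋪s₁ → runs-skip (otherwise (λ c → s₀⋪s₁ (c 0 z≤n)) _ refl))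
    where
    b+2<M : 2 ℕ.+ b ℕ.< M
    b+2<M = ℕ.≤-<-trans (ℕ.+-monoˡ-≤ b (s≤s (s≤s z≤n))) k+b<M
    first = read {σ} (ℕ.<⇒≤ (ℕ.<⇒≤ b+2<M)) (holds 0 z≤n)
    second = read {σ} (ℕ.<⇒≤ b+2<M) (holds 1 (s≤s z≤n))
    third = read {σ} b+2<M (holds 2 (s≤s (s≤s z≤n)))
    c = f (s 0) (s 1) ⊓ f (s 1) (s 2)
    σ′ = setReal 1 (reals σ 1 + c) σ
    addMinimum : Runs T _ (λ σ₁ → σ₁ ≡ σ′) σ
    addMinimum = runs-branch (f (s 0) (s 1) <? f (s 1) (s 2)) (δ⇓ first second <ʳ δ⇓ second third)
      (λ lt → runs-real (lit 1) 1<M (readʳ 1<M +ʳ δ⇓ first second)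
        (cong (λ v → setReal 1 (reals σ 1 + v) σ) (sym (⊓-< lt))))
      (λ ge → runs-real (lit 1) 1<M (readʳ 1<M +ʳ δ⇓ second third)
        (cong (λ v → setReal 1 (reals σ 1 + v) σ) (sym (⊓-≮ ge))))
    later : s 0 ◁ s 1 → Runs T (evaluate P k (suc b)) Q σ′
    later s₀◁s₁ = runs-evaluate k (suc b) (s ∘ suc) σ′
      (subst (ℕ._< M) (sym (ℕ.+-suc (suc k) b)) k+b<M)
      (λ m m≤1+k → trans (cong (ints σ) (ℕ.+-suc m b)) (holds (suc m) (s≤s m≤1+k)))
      (λ chain ρ ρ₀ ρ₁ → onChain (λ { zero _ → s₀◁s₁ ; (suc m) (s≤s m≤k) → chain m m≤k }) ρ ρ₀
        (trans ρ₁ (+-assoc (reals σ 1) c (tailVal k (s ∘ suc)))))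
      (λ ¬chain → otherwise (¬chain ∘ chain-tail))

  runs-copy : ∀ {T σ} m → m ℕ.≤ p → (∀ l → l ℕ.< p → ints σ (l ℕ.+ p) ℕ.≤ W) →
    Runs T (copy p m)
      (λ σ′ → (∀ l → l ℕ.< m → ints σ′ l ≡ ints σ (l ℕ.+ p)) ×
              (∀ l → ints σ′ (l ℕ.+ p) ≡ ints σ (l ℕ.+ p)) × reals σ′ ≡ reals σ) σ
  runs-copy zero    m≤p small = runs-skip ((λ _ ()) , (λ _ → refl) , refl)
  runs-copy {σ = σ} (suc m) m<p small = runs-seq (runs-post
    (λ { σ′ (copied , current , values) →
         runs-int (lit m) (output<M (ℕ.<⇒≤ m<p))
           (read (current<M (ℕ.<⇒≤ m<p)) (current m)) (small m m<p)
           ((λ l l<1+m → [ (λ l<m → trans (update-other (ints σ′) _ (ℕ.<⇒≢ l<m)) (copied l l<m))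
                         , (λ { refl → update-same (ints σ′) m _ }) ]′
                         (ℕ.m≤n⇒m<n∨m≡n (ℕ.≤-pred l<1+m)))
           , (λ l → trans (update-other (ints σ′) _ (output≢current {m = l} m<p ∘ sym)) (current l))
           , values) })
    (runs-copy m (ℕ.<⇒≤ m<p) small))

  Best : Store → Set
  Best σ = reals σ 0 < 0# ⊎
    ∃[ s ] Chain q s × (∀ m → m ℕ.< p → ints σ m ≡ toℕ (s m)) × reals σ 0 ≡ chainVal q s

  runs-tryChain : ∀ {T} s σ → Holds q p s σ → Best σ →
    Runs T (tryChain q)
      (λ σ′ → (∀ l → ints σ′ (l ℕ.+ p) ≡ ints σ (l ℕ.+ p)) × Best σ′ × reals σ 0 ≤ reals σ′ 0 ×
              (Chain q s → chainVal q s ≤ reals σ′ 0)) σ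
  runs-tryChain {T} s σ holds best = runs-seq (runs-real (lit 1) 1<M
    (δ⇓ (read (current<M z≤n) (holds 0 z≤n)) (read (current<M (s≤s z≤n)) (holds 1 (s≤s z≤n))))
    (runs-evaluate q p s _ (current<M (ℕ.n≤1+n (suc q))) holds onChain
      (λ ¬chain ρ ρ₀ → (λ _ → refl) , transport ρ ρ₀ best , inj₂ (sym ρ₀) ,
                       λ chain → contradiction chain ¬chain)))
    where
    transport : ∀ ρ → ρ 0 ≡ reals σ 0 → Best σ → Best ⟨ ints σ , ρ ⟩
    transport ρ ρ₀ (inj₁ neg) = inj₁ (subst (_< 0#) (sym ρ₀) neg)
    transport ρ ρ₀ (inj₂ (s , c , outputs , value)) = inj₂ (s , c , outputs , trans ρ₀ value)
    onChain : Chain q s → ∀ ρ → ρ 0 ≡ reals σ 0 → ρ 1 ≡ chainVal q s →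
      Runs T (recordBetter p)
        (λ σ′ → (∀ l → ints σ′ (l ℕ.+ p) ≡ ints σ (l ℕ.+ p)) × Best σ′ × reals σ 0 ≤ reals σ′ 0 ×
                (Chain q s → chainVal q s ≤ reals σ′ 0)) ⟨ ints σ , ρ ⟩
    onChain c ρ ρ₀ ρ₁ = runs-branch (ρ 0 <? ρ 1) (readʳ 0<M <ʳ readʳ 1<M)
      (λ lt → runs-seq (runs-real (lit 0) 0<M (readʳ 1<M) (runs-post
        (λ { σ′ (copied , current , values) →
             let value : reals σ′ 0 ≡ chainVal q s
                 value = trans (cong (λ ρ → ρ 0) values) ρ₁
             in current ,
                inj₂ (s , c , (λ m m<p → trans (copied m m<p) (holds m (ℕ.≤-pred m<p))) , value) ,
                inj₁ (subst₂ _<_ ρ₀ (trans ρ₁ (sym value)) lt) ,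
                λ _ → inj₂ (sym value) })
        (runs-copy p ℕ.≤-refl
          (λ l l<p → subst (ℕ._≤ W) (sym (holds l (ℕ.≤-pred l<p))) (index≤W (s l)))))))
      (λ ge → runs-skip ((λ _ → refl) , transport ρ ρ₀ best , inj₂ (sym ρ₀) ,
        λ _ → subst (_≤ ρ 0) ρ₁ (≮⇒≥ ge)))

  -- The positions of the current chain that the inner m loops leave fixed.
  Outer : ℕ → ℕ → Set
  Outer m l = l ℕ.≤ suc q × (l ≡ 0 ⊎ m ℕ.< l)

  Fixed : ℕ → Sel → Store → Set
  Fixed m s σ = ∀ l → Outer m l → ints σ (l ℕ.+ p) ≡ toℕ (s l)

  Agree : ℕ → Sel → Sel → Set
  Agree m s s′ = ∀ l → Outer m l → s′ l ≡ s l

  -- `b` is the best value on entry. As the best value never decreases, chains bounded by it earlier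
  -- stay bounded.
  Enumerated : ℕ → Sel → Carrier → (Sel → Set) → Store → Set
  Enumerated m s b covered σ = Fixed m s σ × Best σ × b ≤ reals σ 0 ×
    (∀ s′ → Agree m s s′ → covered s′ → Chain q s′ → chainVal q s′ ≤ reals σ 0)

  outer-suc : ∀ {m l} → Outer (suc m) l → Outer m l × l ≢ suc m
  outer-suc (l≤ , inj₁ refl) = (l≤ , inj₁ refl) , λ ()
  outer-suc (l≤ , inj₂ m<l)  = (l≤ , inj₂ (ℕ.<⇒≤ m<l)) , ℕ.>⇒≢ m<l

  outer-split : ∀ {m l} → Outer m l → l ≡ suc m ⊎ Outer (suc m) l
  outer-split (l≤ , inj₁ l≡0) = inj₂ (l≤ , inj₁ l≡0)
  outer-split (l≤ , inj₂ m<l) with ℕ.m≤n⇒m<n∨m≡n m<l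
  ... | inj₁ 1+m<l = inj₂ (l≤ , inj₂ 1+m<l)
  ... | inj₂ 1+m≡l = inj₁ (sym 1+m≡l)

  outer-zero : ∀ l → l ℕ.≤ suc q → Outer 0 l
  outer-zero zero    l≤ = l≤ , inj₁ refl
  outer-zero (suc l) l≤ = l≤ , inj₂ (s≤s z≤n)

  best-counter : ∀ m {v} σ → Best σ → Best (setInt (m ℕ.+ p) v σ)
  best-counter m σ (inj₁ neg) = inj₁ neg
  best-counter m {v} σ (inj₂ (s , c , outputs , value)) = inj₂ (s , c ,
    (λ l l<p → trans (update-other (ints σ) v (output≢current {m = m} l<p)) (outputs l l<p)) , value)

  fixed-counter : ∀ m {v s} σ → Fixed (suc m) s σ → Fixed (suc m) s (setInt (suc m ℕ.+ p) v σ)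
  fixed-counter m {v} σ fixed l outer = trans
    (update-other (ints σ) v (current-injective (proj₂ (outer-suc outer)))) (fixed l outer)

  runs-enumerate : ∀ {T} m → m ℕ.≤ q → n ℕ.^ m ℕ.≤ suc T → ∀ s σ → Fixed m s σ → Best σ →
    Runs T (enumerate q m)
      (λ σ′ → Fixed m s σ′ × Best σ′ × reals σ 0 ≤ reals σ′ 0 ×
              (∀ s′ → Agree m s s′ → Chain q s′ → chainVal q s′ ≤ reals σ′ 0)) σ
  runs-enumerate zero _ _ s σ fixed best = runs-post
    (λ { σ′ (current , best′ , grows , covers) →
         (λ l outer → trans (current l) (fixed l outer)) , best′ , grows ,
         -- With no loops left every position is prescribed, so `s′` coincides with the one chain
         -- just evaluated.
         λ s′ agree c′ →
           let s≡s′ = λ m m≤ → agree m (outer-zero m m≤)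
           in subst (_≤ reals σ′ 0) (sym (chainVal-cong q s≡s′))
                (covers λ m m≤q → subst₂ _◁_ (s≡s′ m (ℕ.m≤n⇒m≤1+n m≤q)) (s≡s′ (suc m) (s≤s m≤q)) (c′ m m≤q)) })
    (runs-tryChain s σ (λ m m≤ → fixed m (outer-zero m m≤)) best)
  runs-enumerate {T} (suc m) m<q fits s σ fixed best =
    runs-forPoints {T = ℕ.pred (n ℕ.^ m)}
      (λ t → Enumerated (suc m) s (reals σ 0) (λ s′ → toℕ (s′ (suc m)) ℕ.< t))
      (λ _ → lit (suc m ℕ.+ p)) counter<M n≤W
      (subst (λ k → n ℕ.* k ℕ.≤ suc T) (sym (ℕ.suc-pred (n ℕ.^ m))) fits)
      body
      (fixed-counter m σ fixed , best-counter (suc m) σ best , ≤-refl , λ _ _ ())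
      (λ { σ′ (fixed , best , grows , covers) → fixed , best , grows ,
           λ s′ agree → covers s′ agree (Fin.toℕ<n (s′ (suc m))) })
    where
    instance n^m≢0 = ℕ.m^n≢0 n m
    counter<M : suc m ℕ.+ p ℕ.< M
    counter<M = current<M (ℕ.≤-trans m<q (ℕ.m≤n+m q 2))
    body : ∀ h σ₁ → ints σ₁ (suc m ℕ.+ p) ≡ toℕ h →
      Enumerated (suc m) s (reals σ 0) (λ s′ → toℕ (s′ (suc m)) ℕ.< toℕ h) σ₁ →
      Runs (ℕ.pred (n ℕ.^ m)) (enumerate q m)
        (λ σ′ → ints σ′ (suc m ℕ.+ p) ≡ toℕ h ×
                Enumerated (suc m) s (reals σ 0) (λ s′ → toℕ (s′ (suc m)) ℕ.< suc (toℕ h))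
                  (setInt (suc m ℕ.+ p) (suc (toℕ h)) σ′)) σ₁
    body h σ₁ h≡ (fixed₁ , best₁ , grows₁ , covers₁) = runs-post
      (λ { σ′ (fixed′ , best′ , grows′ , covers′) →
           trans (fixed′ (suc m) outer-m) (cong toℕ (update-same s (suc m) h)) ,
           fixed-counter m {s = s} σ′ (λ l outer → trans (fixed′ l (proj₁ (outer-suc outer)))
             (cong toℕ (update-other s h (proj₂ (outer-suc outer))))) ,
           best-counter (suc m) σ′ best′ , ≤-trans grows₁ grows′ ,
           λ s′ agree s′< c′ →
             [ (λ lt → ≤-trans (covers₁ s′ agree lt c′) grows′)
             , (λ s′≡h → covers′ s′ (extended s′ agree s′≡h) c′) ]′ (toℕ-<suc s′<) })
      (runs-enumerate m (ℕ.<⇒≤ m<q) (ℕ.≤-reflexive (sym (ℕ.suc-pred (n ℕ.^ m)))) s₁ σ₁ fixed-h best₁)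
      where
      s₁ : Sel
      s₁ = update s (suc m) h
      outer-m : Outer m (suc m)
      outer-m = s≤s (ℕ.<⇒≤ m<q) , inj₂ ℕ.≤-refl
      fixed-h : Fixed m s₁ σ₁
      fixed-h l outer with outer-split outer
      ... | inj₁ refl = trans h≡ (cong toℕ (sym (update-same s (suc m) h)))
      ... | inj₂ outer′ = trans (fixed₁ l outer′)
        (cong toℕ (sym (update-other s h (proj₂ (outer-suc outer′)))))
      extended : ∀ s′ → Agree (suc m) s s′ → s′ (suc m) ≡ h → Agree m s₁ s′
      extended s′ agree s′≡h l outer with outer-split outer
      ... | inj₁ refl = trans s′≡h (sym (update-same s (suc m) h))
      ... | inj₂ outer′ = trans (agree l outer′) (sym (update-other s h (proj₂ (outer-suc outer′))))

  Leftmost : Fin n → ℕ → Set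
  Leftmost l t = ∀ i → toℕ i ℕ.< t → ¬ i ◁ l

  Rightmost : Fin n → ℕ → Set
  Rightmost r t = ∀ i → toℕ i ℕ.< t → ¬ r ◁ i

  -- Two counts, because within a pass the left end has already met the current point when the right
  -- end has not.
  Extremes : ℕ → ℕ → Store → Set
  Extremes t t′ σ =
    (∃[ l ] ints σ (0 ℕ.+ p) ≡ toℕ l × Leftmost l t) ×
    (∃[ r ] ints σ (suc q ℕ.+ p) ≡ toℕ r × Rightmost r t′)

  runs-findExtremes : ∀ {T} → n ℕ.≤ suc T → Runs T (findExtremes q) (Extremes n n) initial
  runs-findExtremes {T} n≤ = runs-forPoints {T = 0} (λ t → Extremes t t)
    (λ _ → lit (p ℕ.+ p)) enough n≤W (ℕ.≤-trans (ℕ.≤-reflexive (ℕ.*-identityʳ n)) n≤)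
    body
    (counter 0 initial ((zero , refl , λ _ ()) , (zero , refl , λ _ ())))
    (λ _ extremes → extremes)
    where
    last≢p : suc q ≢ p
    last≢p = ℕ.<⇒≢ ℕ.≤-refl
    counter : ∀ {t t′} v σ → Extremes t t′ σ → Extremes t t′ (setInt (p ℕ.+ p) v σ)
    counter v σ ((l , l≡ , left) , (r , r≡ , right)) =
      (l , trans (update-other (ints σ) v (current-injective {0} {p} λ ())) l≡ , left) ,
      (r , trans (update-other (ints σ) v (current-injective last≢p)) r≡ , right)
    left-step : ∀ {l} h → Leftmost l (toℕ h) → ¬ h ◁ l → Leftmost l (suc (toℕ h))
    left-step h left h⋪l i i≤h = [ left i , (λ { refl → h⋪l }) ]′ (toℕ-<suc i≤h)
    right-step : ∀ {r} h → Rightmost r (toℕ h) → ¬ r ◁ h → Rightmost r (suc (toℕ h))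
    right-step h right r⋪h i i≤h = [ right i , (λ { refl → r⋪h }) ]′ (toℕ-<suc i≤h)
    updateRight : ∀ h σ → ints σ (p ℕ.+ p) ≡ toℕ h → Extremes (suc (toℕ h)) (toℕ h) σ →
      Runs 0 (branch (x¹[ int[ lit (suc q ℕ.+ p) ] ] <ʳ x¹[ int[ lit (p ℕ.+ p) ] ])
                (int[ lit (suc q ℕ.+ p) ]≔ int[ lit (p ℕ.+ p) ]) skip)
        (λ σ′ → ints σ′ (p ℕ.+ p) ≡ toℕ h ×
                Extremes (suc (toℕ h)) (suc (toℕ h)) (setInt (p ℕ.+ p) (suc (toℕ h)) σ′)) σ
    updateRight h σ h≡ ((l , l≡ , left) , (r , r≡ , right)) =
      runs-branch (proj₁ (x r) <? proj₁ (x h)) (x¹[ read last<M r≡ ] <ʳ x¹[ read enough h≡ ])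
        (λ r◁h → runs-int (lit (suc q ℕ.+ p)) last<M (read enough h≡) (index≤W h)
          (trans (update-other (ints σ) _ (current-injective (last≢p ∘ sym))) h≡ ,
           counter _ (setInt (suc q ℕ.+ p) (toℕ h) σ)
             ((l , trans (update-other (ints σ) _ (current-injective {0} {suc q} λ ())) l≡ , left) ,
              (h , update-same (ints σ) (suc q ℕ.+ p) _ ,
               right-step h (λ i i<h h◁i → right i i<h (<-trans r◁h h◁i)) (<-irrefl refl)))))
        (λ r⋪h → runs-skip (h≡ , counter _ σ ((l , l≡ , left) , (r , r≡ , right-step h right r⋪h))))
      where
      last<M : suc q ℕ.+ p ℕ.< M
      last<M = current<M (ℕ.n≤1+n (suc q))
    body : ∀ h σ → ints σ (p ℕ.+ p) ≡ toℕ h → Extremes (toℕ h) (toℕ h) σ →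
      Runs 0 _ (λ σ′ → ints σ′ (p ℕ.+ p) ≡ toℕ h ×
                       Extremes (suc (toℕ h)) (suc (toℕ h)) (setInt (p ℕ.+ p) (suc (toℕ h)) σ′)) σ
    body h σ h≡ ((l , l≡ , left) , (r , r≡ , right)) = runs-seq
      (runs-branch (proj₁ (x h) <? proj₁ (x l)) (x¹[ read enough h≡ ] <ʳ x¹[ read (current<M z≤n) l≡ ])
        (λ h◁l → runs-int (lit p) (current<M z≤n) (read enough h≡) (index≤W h)
          (updateRight h _ (trans (update-other (ints σ) _ (current-injective {p} {0} λ ())) h≡)
            ((h , update-same (ints σ) p _ ,
              left-step h (λ i i<h i◁h → left i i<h (<-trans i◁h h◁l)) (<-irrefl refl)) ,
             (r , trans (update-other (ints σ) _ (current-injective {suc q} {0} λ ())) r≡ , right))))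
        (λ h⋪l → runs-skip (updateRight h σ h≡
          ((l , l≡ , left-step h left h⋪l) , (r , r≡ , right)))))

  -- The two bounds pay for the two phases; for p = 2 finding the extremes dominates the single
  -- evaluation.
  runs-exhaustiveSearch : ∀ {T} → n ℕ.≤ suc T → n ℕ.^ q ℕ.≤ suc T →
                          Runs T (exhaustiveSearch q) Solved initial
  runs-exhaustiveSearch {T} n≤ n^q≤ = runs-seq (runs-post search (runs-findExtremes n≤))
    where
    search : ∀ σ → Extremes n n σ → Runs T (real[ lit 0 ]≔ 0ʳ -ʳ 1ʳ ⨾ enumerate q q) Solved σ
    search σ ((l , l≡ , left) , (r , r≡ , right)) = runs-seq (runs-real (lit 0) 0<M (0ʳ -ʳ 1ʳ)
      (runs-post finish (runs-enumerate q ℕ.≤-refl n^q≤ ends _ fixed (inj₁ -1<0))))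
      where
      ends : Sel
      ends = l ◂ λ _ → r
      fixed : Fixed q ends (setReal 0 -1# σ)
      fixed zero    _ = l≡
      -- The two inequalities leave only the last position, `1 + q`.
      fixed (suc m) (s≤s m≤q , inj₂ q<1+m) =
        trans (cong (λ k → ints σ (suc k ℕ.+ p)) (ℕ.≤-antisym m≤q (ℕ.≤-pred q<1+m))) r≡
      finish : ∀ σ′ → Fixed q ends σ′ × Best σ′ × -1# ≤ reals σ′ 0 ×
                      (∀ s′ → Agree q ends s′ → Chain q s′ → chainVal q s′ ≤ reals σ′ 0) → Solved σ′
      finish σ′ (_ , best , _ , covers) = optimum best
        where
        bound : ∀ s → Chain q s → chainVal q s ≤ reals σ′ 0
        bound s c =
          let s′ , c′ , first , last , s≤s′ =
                widen (λ i → left i (Fin.toℕ<n i)) (λ i → right i (Fin.toℕ<n i)) q c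
              agree : Agree q ends s′
              agree = λ { zero _ → first
                        ; (suc m) (s≤s m≤q , inj₂ q<1+m) →
                            trans (cong (s′ ∘ suc) (ℕ.≤-antisym m≤q (ℕ.≤-pred q<1+m))) last }
          in ≤-trans s≤s′ (covers s′ agree c′)
        optimum : Best σ′ → Solved σ′
        optimum (inj₁ neg) = let s , c = chain-exists q p≤n in
          contradiction neg (≤⇒≯ (≤-trans (0≤chainVal q s) (bound s c)))
        optimum (inj₂ (s , c , outputs , value)) =
          s , c , outputs , value , λ s′ c′ → subst (chainVal q s′ ≤_) value (bound s′ c′)

-- Complexity bounds

open import Data.Nat using (_*_; _^_; _<_)

module Solvable (ℝ : Reals) (α : Reals.Carrier ℝ) (0<α : Reals._<_ ℝ (Reals.0# ℝ) α) where
  open Complexity ℝ α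

  n≤c*n^1 : ∀ c n → n ℕ.≤ suc c * n ^ 1
  n≤c*n^1 c n = ℕ.≤-trans (ℕ.≤-reflexive (sym (ℕ.*-identityʳ n))) (ℕ.m≤n*m (n ^ 1) (suc c))

  exhaustiveSearch-solves : ∀ q (time : ℕ → ℕ) → (∀ n → suc n ℕ.≤ time (suc n)) →
    (∀ n → suc n ^ q ℕ.≤ time (suc n)) →
    SolvableIn (λ p → p ≡ 2 ℕ.+ q) (λ n p → time n) (λ n p → 1)
  exhaustiveSearch-solves q time n≤time n^q≤time = exhaustiveSearch q , c , 1 , solves
    where
    -- `cells` is 2p + 1: output, current chain and the counter of `findExtremes`. One constant has
    -- to serve time, memory and word length, hence the sum with the size.
    cells c : ℕ
    cells = suc (2 ℕ.+ q ℕ.+ (2 ℕ.+ q))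
    c = cells ℕ.+ size (exhaustiveSearch q)
    memory : ∀ {m} → m ℕ.≤ cells → m ℕ.≤ c * 1
    memory m≤ = ℕ.≤-trans m≤ (ℕ.≤-trans (ℕ.m≤m+n cells _) (ℕ.m≤m*n c 1))
    solves : ∀ n p → 2 ℕ.≤ p → p ℕ.≤ n → p ≡ 2 ℕ.+ q →
             SolvesWithin (exhaustiveSearch q) n p (c * time n) (c * 1) (c * n ^ 1)
    solves (suc n) _ _ p≤n refl =
      memory (ℕ.m≤n⇒m≤1+n (ℕ.m≤m+n _ _)) ,
      λ x pareto →
        Solution.solved ℝ α 0<α q x pareto _ _
          (ExhaustiveSearch.runs-exhaustiveSearch ℝ α 0<α n q x pareto p≤n _ _
            (memory ℕ.≤-refl) (n≤c*n^1 (2 ℕ.+ q ℕ.+ (2 ℕ.+ q) ℕ.+ size (exhaustiveSearch q)) (suc n))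
            (subst (suc n ℕ.≤_) 1+T≡ (n≤time n)) (subst (suc n ^ q ℕ.≤_) 1+T≡ (n^q≤time n)))
          (subst (λ t → size (exhaustiveSearch q) * t ℕ.≤ c * time (suc n)) 1+T≡
            (ℕ.*-monoˡ-≤ (time (suc n)) (ℕ.m≤n+m (size (exhaustiveSearch q)) cells)))
      where
      1+T≡ : time (suc n) ≡ suc (ℕ.pred (time (suc n)))
      1+T≡ = sym (ℕ.suc-pred (time (suc n)) {{ℕ.>-nonZero (ℕ.≤-trans (s≤s z≤n) (n≤time n))}})

  dynamicProgram-solves : ∀ n p {time memory word} → 2 ℕ.≤ p → p ℕ.≤ n →
    size dynamicProgram * (p * n ^ 3) ℕ.≤ time → 10 * (p * n ^ 2) ℕ.≤ memory → n ℕ.≤ word →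
    SolvesWithin dynamicProgram n p time memory word
  dynamicProgram-solves (suc n) (suc (suc q)) {time} {memory} (s≤s (s≤s _)) p≤n time≤ memory≤ n≤W =
    ℕ.≤-trans (ℕ.≤-trans (ℕ.m≤m+n _ _) (ℕ.m≤n+m _ 8)) enough ,
    λ x pareto →
      Solution.solved ℝ α 0<α q x pareto _ _
        (DynamicProgram.runs-dynamicProgram ℝ α 0<α n q x pareto p≤n _ _ enough n≤W)
        (subst (λ t → size dynamicProgram * (p * (N * (N * t))) ℕ.≤ time) (ℕ.*-identityʳ N) time≤)
    where
    N = suc n
    p = suc (suc q)
    X = p * N ^ 2
    table : p * N * N ≡ X
    table = trans (ℕ.*-assoc p N N) (cong (λ t → p * (N * t)) (sym (ℕ.*-identityʳ N)))
    enough : 8 ℕ.+ (p ℕ.+ p * N * N) ℕ.≤ memory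
    -- The factor 10 is 8 + 1 + 1: the reserved low cells, the p output cells and the table are
    -- bounded by 8, 1 and 1 times pn².
    enough = ℕ.≤-trans (begin
      8 ℕ.+ (p ℕ.+ p * N * N)  ≤⟨ ℕ.+-mono-≤ (ℕ.m≤m*n 8 X) (ℕ.+-mono-≤ (ℕ.m≤m*n p (N ^ 2)) (ℕ.≤-reflexive table)) ⟩
      8 * X ℕ.+ (X ℕ.+ X)      ≡⟨ cong (λ t → 8 * X ℕ.+ (X ℕ.+ t)) (ℕ.+-identityʳ X) ⟨
      8 * X ℕ.+ 2 * X          ≡⟨ ℕ.*-distribʳ-+ X 8 2 ⟨
      10 * X                   ∎) memory≤
      where open ℕ.≤-Reasoning

  dynamicConstant : ℕ
  dynamicConstant = 10 ℕ.+ size dynamicProgram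

  size≤ : size dynamicProgram ℕ.≤ dynamicConstant
  size≤ = ℕ.m≤n+m (size dynamicProgram) 10

  10≤ : 10 ℕ.≤ dynamicConstant
  10≤ = ℕ.m≤m+n 10 (size dynamicProgram)

  dynamicProgram-polynomial : PolynomiallySolvable
  -- Since p ≤ n, the time pn³ is at most n⁴; the memory pn² is at most n³ and is raised to the same
  -- exponent.
  dynamicProgram-polynomial = 4 , dynamicProgram , dynamicConstant , 1 , λ n p 2≤p p≤n _ →
    dynamicProgram-solves n p 2≤p p≤n
      (ℕ.*-mono-≤ size≤ (ℕ.*-monoˡ-≤ (n ^ 3) p≤n))
      (ℕ.*-mono-≤ 10≤ (ℕ.≤-trans (ℕ.*-monoˡ-≤ (n ^ 2) p≤n) (n^3≤n^4 n (ℕ.≤-trans 2≤p p≤n))))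
      (n≤c*n^1 (9 ℕ.+ size dynamicProgram) n)
    where
    n^3≤n^4 : ∀ n → 2 ℕ.≤ n → n ^ 3 ℕ.≤ n ^ 4
    n^3≤n^4 (suc n) _ = ℕ.m≤n*m (suc n ^ 3) (suc n)

  dynamicProgram-solvable : SolvableIn (λ p → 5 < p) (λ n p → p * n ^ 3) (λ n p → p * n ^ 2)
  dynamicProgram-solvable = dynamicProgram , dynamicConstant , 1 , λ n p 2≤p p≤n _ →
    dynamicProgram-solves n p 2≤p p≤n
      (ℕ.*-monoˡ-≤ (p * n ^ 3) size≤) (ℕ.*-monoˡ-≤ (p * n ^ 2) 10≤) (n≤c*n^1 (9 ℕ.+ size dynamicProgram) n)

theorem3 : (ℝ : Reals) (α : Reals.Carrier ℝ) → Reals._<_ ℝ (Reals.0# ℝ) α →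
    let open Complexity ℝ α in
    PolynomiallySolvable
    × SolvableIn (λ p → p ≡ 2) (λ n p → n) (λ n p → 1)
    × SolvableIn (λ p → p ≡ 3) (λ n p → n) (λ n p → 1)
    × SolvableIn (λ p → p ≡ 4) (λ n p → n ^ 2) (λ n p → 1)
    × SolvableIn (λ p → p ≡ 5) (λ n p → n ^ 3) (λ n p → 1)
    × SolvableIn (λ p → 5 < p) (λ n p → p * n ^ 3) (λ n p → p * n ^ 2)
theorem3 ℝ α 0<α =
    dynamicProgram-polynomial
  , exhaustiveSearch-solves 0 (λ n → n) (λ _ → ℕ.≤-refl) (λ _ → s≤s z≤n)
  , exhaustiveSearch-solves 1 (λ n → n) (λ _ → ℕ.≤-refl) (λ n → ℕ.≤-reflexive (ℕ.*-identityʳ (suc n)))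
  , exhaustiveSearch-solves 2 (λ n → n ^ 2) (λ n → ℕ.m≤m*n (suc n) (suc n ^ 1)) (λ _ → ℕ.≤-refl)
  , exhaustiveSearch-solves 3 (λ n → n ^ 3) (λ n → ℕ.m≤m*n (suc n) (suc n ^ 2)) (λ _ → ℕ.≤-refl)
  , dynamicProgram-solvable
  where open Solvable ℝ α 0<α
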